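{- Let $G$ be a (finite, simple) plane graph with minimum degree $5$ and maximum degree $\Delta\ge 16$. Then $G$ has a minor $5$-star with weight at most $\Delta+28$.
   Context: A plane graph is a graph embedded in the plane without edge crossings. A minor $5$-star in $G$ is a vertex of degree exactly $5$ (its center) together with its five neighbors. The weight of a subgraph $H$ of $G$ is $\sum_{v\in V(H)}\deg_G(v)$. -}

module Defs where

open import Data.Nat using (ℕ; zero; suc; _+_; _*_; _≤_; _<ᵇ_; _≡ᵇ_)
open import Data.Fin using (Fin; toℕ)
import Data.Fin as F
open import Data.Bool using (Bool; true; false; if_then_else_; _∧_; _∨_; not)
open import Data.Product using (_×_; _,_; Σ; ∃; proj₁; proj₂)
open import Relation.Binary.PropositionalEquality using (_≡_)

record Graph (n : ℕ) : Set where
  field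
    adj    : Fin n → Fin n → Bool
    sym    : ∀ u v → adj u v ≡ adj v u
    irrefl : ∀ v → adj v v ≡ false
open Graph public

sumF : ∀ {n} → (Fin n → ℕ) → ℕ
sumF {zero}  f = 0
sumF {suc n} f = f F.zero + sumF (λ i → f (F.suc i))

count : ∀ {n} → (Fin n → Bool) → ℕ
count f = sumF (λ i → if f i then 1 else 0)

anyF : ∀ {n} → (Fin n → Bool) → Bool
anyF {zero}  f = false
anyF {suc n} f = f F.zero ∨ anyF (λ i → f (F.suc i))

iter : ∀ {A : Set} → (A → A) → ℕ → A → A
iter f zero    x = x
iter f (suc k) x = f (iter f k x)

module _ {n : ℕ} (G : Graph n) where

  deg : Fin n → ℕ
  deg v = count (adj G v)

  starWeight : Fin n → ℕ
  starWeight v = deg v + sumF (λ u → if adj G v u then deg u else 0)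

  edges : ℕ
  edges = sumF (λ u → count (λ v → adj G u v ∧ (toℕ u <ᵇ toℕ v)))

  isolated : ℕ
  isolated = count (λ v → deg v ≡ᵇ 0)

  reach : ℕ → Fin n → Fin n → Bool
  reach zero    u v = toℕ u ≡ᵇ toℕ v
  reach (suc k) u v = reach k u v ∨ anyF (λ w → reach k u w ∧ adj G w v)

  -- number of connected components (vertices that are the least vertex of their component)
  components : ℕ
  components = count (λ v → not (anyF (λ w → (toℕ w <ᵇ toℕ v) ∧ reach n w v)))

  -- A rotation system: for each vertex v, a cyclic permutation  rot v  of the
  -- neighbourhood of v (the clockwise order of the edges around v).
  record Rotation : Set where
    field
      rot     : Fin n → Fin n → Fin n
      rot-adj : ∀ v u → adj G v u ≡ true → adj G v (rot v u) ≡ true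
      rot-inj : ∀ v u w → adj G v u ≡ true → adj G v w ≡ true →
                rot v u ≡ rot v w → u ≡ w
      rot-cyc : ∀ v u w → adj G v u ≡ true → adj G v w ≡ true →
                ∃ λ k → iter (rot v) k u ≡ w

  module _ (R : Rotation) where
    open Rotation R

    -- face-tracing permutation on darts (u , v) (u adjacent to v)
    φ : Fin n × Fin n → Fin n × Fin n
    φ (u , v) = (v , rot v u)

    key : Fin n × Fin n → ℕ
    key (u , v) = toℕ u * n + toℕ v

    -- a dart is the representative of its face (φ-orbit) if it has the least key
    -- in its orbit (orbits have size ≤ number of darts ≤ n * n)
    isFaceRep : Fin n × Fin n → Bool
    isFaceRep d = not (anyOrbit (n * n))
      where
        anyOrbit : ℕ → Bool
        anyOrbit zero    = false
        anyOrbit (suc k) = (key (iter φ k d) <ᵇ key d) ∨ anyOrbit k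

    faces : ℕ
    faces = sumF (λ u → count (λ v → adj G u v ∧ isFaceRep (u , v)))

  -- G is planar (admits a plane embedding): there is a rotation system of Euler
  -- genus 0, i.e. every component satisfies Euler's formula V - E + F = 2
  -- (an isolated vertex has no darts and counts as one face).  Summed over the
  -- components this is  V + F + #isolated = E + 2 * #components.
  Planar : Set
  Planar = Σ Rotation λ R → n + faces R + isolated ≡ edges + 2 * components

{-# OPTIONS --safe #-}
-- Discharging, with all charges multiplied by 240.  A vertex of degree d gets 240 (d − 6), and each
-- corner of a face of length at least 4 gets 120; by Euler's formula the total charge is negative.
-- A vertex of degree d ≥ 7 spreads its charge evenly over its corners, where it goes to the
-- neighbours of degree 5 (Lebesgue's rule).  If every minor 5-star has weight above Δ + 28, then a
-- 5-vertex receives the 240 it needs, except that a poor one, with only triangles around it and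
-- neighbours of degrees 9, 5, D, 5, 5 in cyclic order (D ≥ 16), may lack 10.  Consecutive poor
-- neighbours of a 9-vertex share alternately the big vertex D and a 5-vertex; as 9 is odd, they are
-- not all poor, and the 5-vertices next to the runs of poor ones have enough surplus to pay for them.
-- All this involves degrees only up to min d 16, so that the local inequality at a 5-vertex is a
-- finite check.
module Submission where

open import Defs
open import Algebra.Properties.CommutativeSemigroup using (interchange)
open import Data.Bool using (Bool; true; false; if_then_else_; _∧_; _∨_; not; T)
open import Data.Bool.Properties using (not-¬; ∨-zeroʳ; ∧-conicalˡ; ∧-conicalʳ)
open import Data.Empty using (⊥; ⊥-elim)
open import Data.Fin using (Fin; toℕ)
import Data.Fin as F
import Data.Fin.Properties as FP
open import Data.Nat
open import Data.Nat.Induction using (<-rec)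
open import Data.Nat.Properties
open import Data.Nat.Tactic.RingSolver using (solve-∀)
open import Data.Product
open import Data.Product.Properties using (≡-dec)
open import Data.Sum using (_⊎_; inj₁; inj₂)
open import Function using (_∘_)
open import Relation.Binary.Definitions using (tri<; tri≈; tri>)
open import Relation.Binary.PropositionalEquality hiding (sym)
import Relation.Binary.PropositionalEquality as ≡
open import Relation.Nullary
open import Relation.Nullary.Decidable using (_×-dec_)

-- Finite sums and cyclic permutations

⟦_⟧ : Bool → ℕ
⟦ b ⟧ = if b then 1 else 0

sumF-cong : ∀ {n} {f g : Fin n → ℕ} → (∀ i → f i ≡ g i) → sumF f ≡ sumF g
sumF-cong {zero}  h = refl
sumF-cong {suc n} h = cong₂ _+_ (h F.zero) (sumF-cong (h ∘ F.suc))

sumF-mono : ∀ {n} {f g : Fin n → ℕ} → (∀ i → f i ≤ g i) → sumF f ≤ sumF g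
sumF-mono {zero}  h = z≤n
sumF-mono {suc n} h = +-mono-≤ (h F.zero) (sumF-mono (h ∘ F.suc))

sumF-+ : ∀ {n} (f g : Fin n → ℕ) → sumF (λ i → f i + g i) ≡ sumF f + sumF g
sumF-+ {zero}  f g = refl
sumF-+ {suc n} f g =
  ≡.trans (cong (f F.zero + g F.zero +_) (sumF-+ (f ∘ F.suc) (g ∘ F.suc)))
          (interchange +-commutativeSemigroup (f F.zero) (g F.zero) _ _)

sumF-* : ∀ {n} c (f : Fin n → ℕ) → sumF (λ i → c * f i) ≡ c * sumF f
sumF-* {zero}  c f = ≡.sym (*-zeroʳ c)
sumF-* {suc n} c f =
  ≡.trans (cong (c * f F.zero +_) (sumF-* c (f ∘ F.suc))) (≡.sym (*-distribˡ-+ c _ _))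

sumF-const : ∀ n c → sumF {n} (λ _ → c) ≡ n * c
sumF-const zero    c = refl
sumF-const (suc n) c = cong (c +_) (sumF-const n c)

sumF-zero : ∀ {n} {f : Fin n → ℕ} → (∀ i → f i ≡ 0) → sumF f ≡ 0
sumF-zero {n} h = ≡.trans (sumF-cong h) (≡.trans (sumF-const n 0) (*-zeroʳ n))

sumF-swap : ∀ {m n} (f : Fin m → Fin n → ℕ) →
            sumF (λ i → sumF (f i)) ≡ sumF (λ j → sumF (λ i → f i j))
sumF-swap {zero}  {n} f = ≡.sym (sumF-zero {n} (λ _ → refl))
sumF-swap {suc m} f =
  ≡.trans (cong (sumF (f F.zero) +_) (sumF-swap (f ∘ F.suc)))
          (≡.sym (sumF-+ (f F.zero) (λ j → sumF (λ i → f (F.suc i) j))))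

sumF-single : ∀ {n} (w : Fin n) (f : Fin n → ℕ) → (∀ u → w ≢ u → f u ≡ 0) → sumF f ≡ f w
sumF-single F.zero f h =
  ≡.trans (cong (f F.zero +_) (sumF-zero (λ i → h (F.suc i) (λ ())))) (+-identityʳ _)
sumF-single (F.suc w) f h =
  ≡.trans (cong (_+ sumF (f ∘ F.suc)) (h F.zero (λ ())))
          (sumF-single w (f ∘ F.suc) (λ u ne → h (F.suc u) (ne ∘ FP.suc-injective)))

-- Both sides add up `g 0` to `g m`.
sumF-shift : ∀ m (g : ℕ → ℕ) →
             sumF {m} (λ i → g (suc (toℕ i))) + g 0 ≡ sumF {m} (λ i → g (toℕ i)) + g m
sumF-shift zero    g = refl
sumF-shift (suc m) g = begin
  g 1 + s₂ + g 0   ≡⟨ cong (_+ g 0) (≡.trans (+-comm (g 1) s₂) (sumF-shift m (g ∘ suc))) ⟩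
  s₁ + g (suc m) + g 0   ≡⟨ +-comm _ (g 0) ⟩
  g 0 + (s₁ + g (suc m)) ≡⟨ ≡.sym (+-assoc (g 0) s₁ _) ⟩
  g 0 + s₁ + g (suc m) ∎
  where
  open ≡-Reasoning
  s₁ = sumF {m} (λ i → g (suc (toℕ i)))
  s₂ = sumF {m} (λ i → g (suc (suc (toℕ i))))

if-+ : ∀ b x y → (if b then x + y else 0) ≡ (if b then x else 0) + (if b then y else 0)
if-+ true  x y = refl
if-+ false x y = refl

if-* : ∀ b c x → (if b then c * x else 0) ≡ c * (if b then x else 0)
if-* true  c x = refl
if-* false c x = ≡.sym (*-zeroʳ c)

if-cong : ∀ b {x y : ℕ} → (b ≡ true → x ≡ y) → (if b then x else 0) ≡ (if b then y else 0)
if-cong true  h = h refl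
if-cong false h = refl

if-mono : ∀ b {x y : ℕ} → (b ≡ true → x ≤ y) → (if b then x else 0) ≤ (if b then y else 0)
if-mono true  h = h refl
if-mono false h = z≤n

decide : ∀ b → b ≡ true ⊎ b ≡ false
decide true  = inj₁ refl
decide false = inj₂ refl

findF : ∀ {n} (P : Fin n → Bool) → (∃ λ i → P i ≡ true) ⊎ (∀ i → P i ≡ false)
findF {zero}  P = inj₂ (λ ())
findF {suc n} P with decide (P F.zero) | findF (P ∘ F.suc)
... | inj₁ p | _            = inj₁ (F.zero , p)
... | inj₂ p | inj₁ (i , q) = inj₁ (F.suc i , q)
... | inj₂ p | inj₂ q       = inj₂ λ { F.zero → p ; (F.suc i) → q i }

least : ∀ {Q : ℕ → Set} → (∀ k → Dec (Q k)) → ∀ {k} → Q k →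
        ∃ λ m → Q m × (∀ j → j < m → ¬ Q j)
least {Q} Q? {k} q = <-rec (λ k → Q k → ∃ λ m → Q m × (∀ j → j < m → ¬ Q j)) step k q
  where
  step : ∀ k → (∀ {j} → j < k → Q j → _) → Q k → ∃ λ m → Q m × (∀ j → j < m → ¬ Q j)
  step k rec q with FP.any? {n = k} (λ i → Q? (toℕ i))
  ... | yes (i , r) = rec (FP.toℕ<n i) r
  ... | no  none    = k , q , λ j j<k r →
        none (F.fromℕ< j<k , subst Q (≡.sym (FP.toℕ-fromℕ< j<k)) r)

iter-+ : ∀ {A : Set} (f : A → A) i j x → iter f (i + j) x ≡ iter f i (iter f j x)
iter-+ f zero    j x = refl
iter-+ f (suc i) j x = cong f (iter-+ f i j x)

iter-suc : ∀ {A : Set} (f : A → A) k x → iter f k (f x) ≡ f (iter f k x)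
iter-suc f zero    x = refl
iter-suc f (suc k) x = cong f (iter-suc f k x)

-- Permutations acting transitively on a subset

module Cycle {n} (P : Fin n → Bool) (r : Fin n → Fin n)
  (closed : ∀ u → P u ≡ true → P (r u) ≡ true)
  (inj : ∀ u w → P u ≡ true → P w ≡ true → r u ≡ r w → u ≡ w)
  (cyc : ∀ u w → P u ≡ true → P w ≡ true → ∃ λ k → iter r k u ≡ w) where

  iter-closed : ∀ k {u} → P u ≡ true → P (iter r k u) ≡ true
  iter-closed zero    p = p
  iter-closed (suc k) p = closed _ (iter-closed k p)

  iter-cancel : ∀ k {u w} → P u ≡ true → P w ≡ true → iter r k u ≡ iter r k w → u ≡ w
  iter-cancel zero    p q e = e
  iter-cancel (suc k) p q e =
    iter-cancel k p q (inj _ _ (iter-closed k p) (iter-closed k q) e)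

  module Orbit (x : Fin n) (px : P x ≡ true) where

    o : ℕ → Fin n
    o i = iter r i x

    private
      returns : ∃ λ k → o (suc k) ≡ x
      returns with cyc (r x) x (closed x px) px
      ... | k , e = k , ≡.trans (≡.sym (iter-suc r k x)) e

      minimal : ∃ λ k → o (suc k) ≡ x × (∀ j → j < k → o (suc j) ≢ x)
      minimal = least (λ k → o (suc k) F.≟ x) {returns .proj₁} (returns .proj₂)

      m : ℕ
      m = suc (minimal .proj₁)

      o-m : o m ≡ x
      o-m = minimal .proj₂ .proj₁

      -- Cancelling `i` steps in a coincidence would bring the orbit back to `x` after `j − i`
      -- steps, fewer than the minimal return time `m`.
      distinct : ∀ i j → i < j → j < m → o i ≢ o j
      distinct i j i<j j<m e =
        minimal .proj₂ .proj₂ k (≤-pred (≤-<-trans (k<j) j<m)) (≡.sym x≡)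
        where
        k = j ∸ suc i
        j≡ : i + suc k ≡ j
        j≡ = ≡.trans (+-suc i k) (m+[n∸m]≡n i<j)
        k<j : suc k ≤ j
        k<j = subst (suc k ≤_) j≡ (m≤n+m (suc k) i)
        x≡ : x ≡ o (suc k)
        x≡ = iter-cancel i px (iter-closed (suc k) px)
               (≡.trans e (≡.trans (cong o (≡.sym j≡)) (iter-+ r i (suc k) x)))

      index : ∀ k → ∃ λ i → i < m × o k ≡ o i
      index zero = 0 , s≤s z≤n , refl
      index (suc k) with index k
      ... | i , i<m , e with m≤n⇒m<n∨m≡n i<m
      ...   | inj₁ si<m = suc i , si<m , cong r e
      ...   | inj₂ refl = 0 , s≤s z≤n , ≡.trans (cong r e) o-m

      hit : Fin n → Fin m → ℕ
      hit u i = ⟦ does (o (toℕ i) F.≟ u) ⟧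

      hit-yes : ∀ {u} i → o (toℕ i) ≡ u → hit u i ≡ 1
      hit-yes {u} i e with o (toℕ i) F.≟ u
      ... | yes _ = refl
      ... | no ne = ⊥-elim (ne e)

      hit-no : ∀ {u} i → o (toℕ i) ≢ u → hit u i ≡ 0
      hit-no {u} i ne with o (toℕ i) F.≟ u
      ... | yes e = ⊥-elim (ne e)
      ... | no _  = refl

      -- By transitivity some iterate reaches `u`; `index` reduces its exponent below `m`, and
      -- `distinct` excludes a second hit.
      hits : ∀ u → ⟦ P u ⟧ ≡ sumF (hit u)
      hits u with decide (P u)
      ... | inj₂ p rewrite p = ≡.sym (sumF-zero (λ i → hit-no i (λ e →
              not-¬ (iter-closed (toℕ i) px) (≡.trans (cong P e) p))))
      ... | inj₁ p rewrite p with cyc x u px p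
      ...   | k , e with index k
      ...     | i , i<m , e′ = ≡.sym (≡.trans (sumF-single w (hit u) others) (hit-yes w at-w))
        where
        w : Fin m
        w = F.fromℕ< i<m
        at-w : o (toℕ w) ≡ u
        at-w = ≡.trans (cong o (FP.toℕ-fromℕ< i<m)) (≡.trans (≡.sym e′) e)
        others : ∀ j → w ≢ j → hit u j ≡ 0
        others j w≢j = hit-no j λ ej → apart (≡.trans at-w (≡.sym ej))
          where
          apart : o (toℕ w) ≢ o (toℕ j)
          apart e with <-cmp (toℕ w) (toℕ j)
          ... | tri< l _ _ = distinct _ _ l (FP.toℕ<n j) e
          ... | tri≈ _ q _ = w≢j (FP.toℕ-injective q)
          ... | tri> _ _ l = distinct _ _ l (FP.toℕ<n w) (≡.sym e)

      if-as-* : ∀ b c → (if b then c else 0) ≡ c * ⟦ b ⟧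
      if-as-* true  c = ≡.sym (*-identityʳ c)
      if-as-* false c = ≡.sym (*-zeroʳ c)

      -- Double counting: `hits` turns the indicator of `P` into a sum over the orbit, and after
      -- exchanging the sums one term survives for each `i`.
      sum-over-m : ∀ (f : Fin n → ℕ) →
                   sumF (λ u → if P u then f u else 0) ≡ sumF {m} (λ i → f (o (toℕ i)))
      sum-over-m f = begin
        sumF (λ u → if P u then f u else 0)
          ≡⟨ sumF-cong (λ u → ≡.trans (if-as-* (P u) (f u)) (≡.trans (cong (f u *_) (hits u))
               (≡.sym (sumF-* (f u) (hit u))))) ⟩
        sumF (λ u → sumF (λ i → f u * hit u i))
          ≡⟨ sumF-swap (λ u i → f u * hit u i) ⟩
        sumF (λ i → sumF (λ u → f u * hit u i))
          ≡⟨ sumF-cong (λ i → ≡.trans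
               (sumF-single (o (toℕ i)) (λ u → f u * hit u i)
                 (λ u ne → ≡.trans (cong (f u *_) (hit-no i ne)) (*-zeroʳ (f u))))
               (≡.trans (cong (f (o (toℕ i)) *_) (hit-yes i refl)) (*-identityʳ (f (o (toℕ i)))))) ⟩
        sumF {m} (λ i → f (o (toℕ i))) ∎
        where open ≡-Reasoning

      -- The orbit sum of the constant 1 is the size of the set.
      m≡count : m ≡ count P
      m≡count = ≡.sym (≡.trans (sum-over-m (λ _ → 1)) (≡.trans (sumF-const m 1) (*-identityʳ m)))

    period : o (count P) ≡ x
    period = subst (λ k → o k ≡ x) m≡count o-m

    orbit-distinct : ∀ i j → i < j → j < count P → o i ≢ o j
    orbit-distinct = subst (λ k → ∀ i j → i < j → j < k → o i ≢ o j) m≡count distinct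

    orbit-sum : ∀ f → sumF (λ u → if P u then f u else 0) ≡ sumF {count P} (λ i → f (o (toℕ i)))
    orbit-sum f =
      subst (λ k → sumF (λ u → if P u then f u else 0) ≡ sumF {k} (λ i → f (o (toℕ i))))
        m≡count (sum-over-m f)

  -- Along an orbit the two sums differ only in their end terms, which agree because the orbit
  -- closes after `count P` steps. An empty set has no orbit to start from and is treated first.
  sum-shift : ∀ f → sumF (λ u → if P u then f (r u) else 0) ≡ sumF (λ u → if P u then f u else 0)
  sum-shift f with findF P
  ... | inj₂ none = sumF-cong (λ u → if-cong (P u) (λ p → ⊥-elim (not-¬ p (none u))))
  ... | inj₁ (x , px) = begin
    sumF (λ u → if P u then f (r u) else 0)    ≡⟨ orbit-sum (f ∘ r) ⟩
    sumF {d} (λ i → f (o (suc (toℕ i))))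
      ≡⟨ +-cancelʳ-≡ (f x) _ _ (≡.trans (sumF-shift d (f ∘ o))
           (cong (λ z → sumF {d} (λ i → f (o (toℕ i))) + f z) period)) ⟩
    sumF {d} (λ i → f (o (toℕ i)))             ≡⟨ ≡.sym (orbit-sum f) ⟩
    sumF (λ u → if P u then f u else 0) ∎
    where
    open ≡-Reasoning
    open Orbit x px
    d = count P

-- Darts and faces

count≤n : ∀ {n} (P : Fin n → Bool) → count P ≤ n
count≤n {n} P = ≤-trans (sumF-mono {g = λ _ → 1} (λ i → if≤1 (P i)))
                        (≤-reflexive (≡.trans (sumF-const n 1) (*-identityʳ n)))
  where
  if≤1 : ∀ b → ⟦ b ⟧ ≤ 1
  if≤1 true  = ≤-refl
  if≤1 false = z≤n

module Rot {n} (G : Graph n) (R : Rotation G) where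
  open Rotation R public

  module C (v : Fin n) = Cycle (adj G v) (rot v) (rot-adj v) (rot-inj v) (rot-cyc v)

  Dart : Fin n × Fin n → Set
  Dart (u , v) = adj G u v ≡ true

  adj-sym : ∀ {u v} → adj G u v ≡ true → adj G v u ≡ true
  adj-sym {u} {v} a = ≡.trans (sym G v u) a

  adj-≢ : ∀ {u v} → adj G u v ≡ true → u ≢ v
  adj-≢ {u} a refl = not-¬ a (irrefl G u)

  nbrSum : Fin n → (Fin n → ℕ) → ℕ
  nbrSum v f = sumF (λ u → if adj G v u then f u else 0)

  dartSum : (Fin n × Fin n → ℕ) → ℕ
  dartSum f = sumF (λ v → nbrSum v (λ u → f (v , u)))

  dartSum-cong : ∀ {f g} → (∀ d → Dart d → f d ≡ g d) → dartSum f ≡ dartSum g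
  dartSum-cong h = sumF-cong λ v → sumF-cong λ u → if-cong (adj G v u) (h (v , u))

  dartSum-mono : ∀ {f g} → (∀ d → Dart d → f d ≤ g d) → dartSum f ≤ dartSum g
  dartSum-mono h = sumF-mono λ v → sumF-mono λ u → if-mono (adj G v u) (h (v , u))

  nbrSum-+ : ∀ v f g → nbrSum v (λ u → f u + g u) ≡ nbrSum v f + nbrSum v g
  nbrSum-+ v f g = ≡.trans (sumF-cong (λ u → if-+ (adj G v u) (f u) (g u)))
    (sumF-+ (λ u → if adj G v u then f u else 0) (λ u → if adj G v u then g u else 0))

  nbrSum-* : ∀ v c f → nbrSum v (λ u → c * f u) ≡ c * nbrSum v f
  nbrSum-* v c f = ≡.trans (sumF-cong (λ u → if-* (adj G v u) c (f u)))
    (sumF-* c (λ u → if adj G v u then f u else 0))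

  dartSum-+ : ∀ f g → dartSum (λ d → f d + g d) ≡ dartSum f + dartSum g
  dartSum-+ f g = ≡.trans (sumF-cong λ v → nbrSum-+ v (λ u → f (v , u)) (λ u → g (v , u)))
    (sumF-+ (λ v → nbrSum v (λ u → f (v , u))) (λ v → nbrSum v (λ u → g (v , u))))

  dartSum-swap : ∀ f → dartSum f ≡ dartSum (f ∘ swap)
  dartSum-swap f = ≡.trans (sumF-swap (λ v u → if adj G v u then f (v , u) else 0))
    (sumF-cong λ v → sumF-cong λ u → cong (λ b → if b then f (u , v) else 0) (sym G u v))

  dartSum-rot : ∀ f → dartSum (λ (v , u) → f (v , rot v u)) ≡ dartSum f
  dartSum-rot f = sumF-cong λ v → C.sum-shift v (λ u → f (v , u))

  φ′ : Fin n × Fin n → Fin n × Fin n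
  φ′ = φ G R

  -- `φ` reverses a dart and then rotates it, and both operations preserve sums over darts.
  dartSum-φ : ∀ f → dartSum (f ∘ φ′) ≡ dartSum f
  dartSum-φ f = ≡.trans (dartSum-swap (f ∘ φ′)) (dartSum-rot f)

  φ-dart : ∀ d → Dart d → Dart (φ′ d)
  φ-dart (u , v) a = rot-adj v u (adj-sym a)

  φ-inj : ∀ d e → Dart d → Dart e → φ′ d ≡ φ′ e → d ≡ e
  φ-inj (u , v) (u′ , v′) a b e with cong proj₁ e
  ... | refl = cong (_, v) (rot-inj v u u′ (adj-sym a) (adj-sym b) (cong proj₂ e))

  φ^-dart : ∀ k {d} → Dart d → Dart (iter φ′ k d)
  φ^-dart zero    a = a
  φ^-dart (suc k) a = φ-dart _ (φ^-dart k a)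

  φ^-inj : ∀ k d e → Dart d → Dart e → iter φ′ k d ≡ iter φ′ k e → d ≡ e
  φ^-inj zero    d e a b q = q
  φ^-inj (suc k) d e a b q =
    φ^-inj k d e a b (φ-inj _ _ (φ^-dart k a) (φ^-dart k b) q)

  -- The dart `(u , v)` also stands for the corner at `v` between `u` and `rot v u`. Under minimum
  -- degree 2 no dart returns after one or two steps, so a return after three means a face of length
  -- exactly 3.
  triangle : Fin n × Fin n → Bool
  triangle d = does (≡-dec F._≟_ F._≟_ (iter φ′ 3 d) d)

  triangle⇒ : ∀ d → triangle d ≡ true → iter φ′ 3 d ≡ d
  triangle⇒ d t with ≡-dec F._≟_ F._≟_ (iter φ′ 3 d) d
  ... | yes e = e

  triangle⇐ : ∀ d → iter φ′ 3 d ≡ d → triangle d ≡ true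
  triangle⇐ d e with ≡-dec F._≟_ F._≟_ (iter φ′ 3 d) d
  ... | yes _ = refl
  ... | no ne = ⊥-elim (ne e)

  triangle-φ : ∀ d → Dart d → triangle (φ′ d) ≡ triangle d
  triangle-φ d a with decide (triangle d) | decide (triangle (φ′ d))
  ... | inj₁ t | _      = ≡.trans (triangle⇐ (φ′ d) (cong φ′ (triangle⇒ d t))) (≡.sym t)
  ... | inj₂ t | inj₂ s = ≡.trans s (≡.sym t)
  ... | inj₂ t | inj₁ s = ⊥-elim (not-¬
    (triangle⇐ d (φ-inj _ _ (φ^-dart 3 a) a (triangle⇒ (φ′ d) s))) t)

  -- The body of smallerIn is found by unification: it is the function local to isFaceRep.
  mutual
    smallerIn : Fin n × Fin n → ℕ → Bool
    smallerIn d k = _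

    isFaceRep-unfold : ∀ d → isFaceRep G R d ≡ not (smallerIn d (n * n))
    isFaceRep-unfold d with n * n
    ... | k = refl

  rep : Fin n × Fin n → Bool
  rep = isFaceRep G R

  smallerIn-true : ∀ d k j → j < k → key G R (iter φ′ j d) < key G R d → smallerIn d k ≡ true
  smallerIn-true d (suc k) j j<sk lt with m≤n⇒m<n∨m≡n (≤-pred j<sk)
  ... | inj₁ j<k  = ≡.trans (cong (smaller ∨_) (smallerIn-true d k j j<k lt)) (∨-zeroʳ smaller)
    where
    smaller = key G R (iter φ′ k d) <ᵇ key G R d
  ... | inj₂ refl = cong (_∨ smallerIn d k) (T⇒≡ _ (<⇒<ᵇ lt))
    where
    T⇒≡ : ∀ b → T b → b ≡ true
    T⇒≡ true _ = refl

  rep-least : ∀ d → rep d ≡ true → ∀ j → j < n * n → key G R d ≤ key G R (iter φ′ j d)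
  rep-least d r j j<N with key G R d ≤? key G R (iter φ′ j d)
  ... | yes p = p
  ... | no  p = ⊥-elim (not-¬ r (≡.trans (isFaceRep-unfold d)
                  (cong not (smallerIn-true d (n * n) j j<N (≰⇒> p)))))

  key-injective : ∀ d e → key G R d ≡ key G R e → d ≡ e
  key-injective d@(u , v) e@(u′ , v′) q = cong₂ _,_ (proj₁ both) (proj₂ both)
    where
    combine-key : ∀ (u v : Fin n) → toℕ (F.combine u v) ≡ key G R (u , v)
    combine-key u v = ≡.trans (FP.toℕ-combine u v) (cong (_+ toℕ v) (*-comm n (toℕ u)))
    both : u ≡ u′ × v ≡ v′
    both = FP.combine-injective u v u′ v′ (FP.toℕ-injective
      (≡.trans (combine-key u v) (≡.trans q (≡.sym (combine-key u′ v′)))))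

  -- Each of two representatives on one orbit has a key at most that of the other, and keys are
  -- injective.
  rep-unique : ∀ d i j → i < n * n → j < n * n → iter φ′ i d ≢ d →
               iter φ′ j (iter φ′ i d) ≡ d → rep d ≡ true → rep (iter φ′ i d) ≡ true → ⊥
  rep-unique d i j i<N j<N moved back r r′ = moved (key-injective _ _ (≤-antisym
    (≤-trans (rep-least _ r′ j j<N) (≤-reflexive (cong (key G R) back)))
    (rep-least d r i i<N)))

  -- Two of the first `n * n + 1` iterates coincide, and injectivity cancels the steps before the
  -- first of them.
  φ-period : ∀ d → Dart d → ∃ λ p → p < n * n × iter φ′ (suc p) d ≡ d
  φ-period d a with FP.pigeonhole (n<1+n (n * n)) (λ k → uncurry F.combine (iter φ′ (toℕ k) d))
  ... | i , j , i<j , e = p , p<N , ≡.sym back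
    where
    p = toℕ j ∸ suc (toℕ i)
    j≡ : toℕ i + suc p ≡ toℕ j
    j≡ = ≡.trans (+-suc (toℕ i) p) (m+[n∸m]≡n i<j)
    p<N : p < n * n
    p<N = ≤-trans (subst (suc p ≤_) j≡ (m≤n+m (suc p) (toℕ i))) (≤-pred (FP.toℕ<n j))
    same : iter φ′ (toℕ i) d ≡ iter φ′ (toℕ j) d
    same = cong₂ _,_ (proj₁ q) (proj₂ q)
      where q = FP.combine-injective _ _ _ _ e
    back : d ≡ iter φ′ (suc p) d
    back = φ^-inj (toℕ i) d _ a (φ^-dart (suc p) a)
      (≡.trans same (≡.trans (cong (λ k → iter φ′ k d) (≡.sym j≡)) (iter-+ φ′ (toℕ i) (suc p) d)))

  -- Bounding the number of faces by the number of darts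

  module FaceCount (deg≥2 : ∀ v → 2 ≤ deg G v) where

    φ≢ : ∀ d → Dart d → φ′ d ≢ d
    φ≢ (u , v) a e = adj-≢ a (≡.sym (cong proj₁ e))

    -- A return after two steps would make `rot v` fix `u`, although `v` has a second neighbour.
    φ²≢ : ∀ d → Dart d → iter φ′ 2 d ≢ d
    φ²≢ (u , v) a e = C.Orbit.orbit-distinct v u (adj-sym a) 0 1 (s≤s z≤n) (deg≥2 v)
                        (≡.sym (cong proj₁ e))

    3<N : Fin n → 3 < n * n
    3<N v = *-mono-≤ n≥2 n≥2
      where n≥2 = ≤-trans (deg≥2 v) (count≤n (adj G v))

    below : ∀ {i} → i ≤ 3 → (d : Fin n × Fin n) → i < n * n
    below i≤3 (v , _) = ≤-<-trans i≤3 (3<N v)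

    rep-triangle : ∀ d → Dart d → triangle d ≡ true → ∀ i j → i + j ≡ 3 →
                   iter φ′ i d ≢ d → rep d ≡ true → rep (iter φ′ i d) ≡ true → ⊥
    rep-triangle d a t i j s moved =
      rep-unique d i j (below (subst (i ≤_) s (m≤m+n i j)) d)
                       (below (subst (j ≤_) s (m≤n+m j i)) d) moved
        (≡.trans (≡.sym (iter-+ φ′ j i d))
          (≡.trans (cong (λ k → iter φ′ k d) (≡.trans (+-comm j i) s)) (triangle⇒ d t)))

    moved≤3 : ∀ d → Dart d → triangle d ≡ false → ∀ i → i < 3 → iter φ′ (suc i) d ≢ d
    moved≤3 d a t 0 _ e = φ≢ d a e
    moved≤3 d a t 1 _ e = φ²≢ d a e
    moved≤3 d a t 2 _ e = not-¬ (triangle⇐ d e) t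
    moved≤3 d a t (suc (suc (suc i))) (s≤s (s≤s (s≤s ()))) e

    -- The period `p + 1` is at least 4, so `p − i` further steps lead back to `d` and `rep-unique`
    -- applies.
    rep-large : ∀ d → Dart d → triangle d ≡ false → ∀ i → i < 3 →
                rep d ≡ true → rep (iter φ′ (suc i) d) ≡ true → ⊥
    rep-large d a t i i<3 with φ-period d a
    ... | p , p<N , e with p <? 3
    ...   | yes p<3 = ⊥-elim (moved≤3 d a t p p<3 e)
    ...   | no  p≮3 =
      rep-unique d (suc i) (p ∸ i) (below i<3 d) (≤-<-trans (m∸n≤m p i) p<N)
        (moved≤3 d a t i i<3)
        (≡.trans (≡.sym (iter-+ φ′ (p ∸ i) (suc i) d))
          (≡.trans (cong (λ k → iter φ′ k d) (≡.trans (+-suc (p ∸ i) i)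
            (cong suc (m∸n+n≡m (<⇒≤ (<-≤-trans i<3 (≮⇒≥ p≮3))))))) e))

    at-most-one₃ : ∀ a b c → (a ≡ true → b ≡ true → ⊥) → (a ≡ true → c ≡ true → ⊥) →
                   (b ≡ true → c ≡ true → ⊥) → ⟦ a ⟧ + (⟦ b ⟧ + ⟦ c ⟧) ≤ 1
    at-most-one₃ true  true  c     x y z = ⊥-elim (x refl refl)
    at-most-one₃ true  false true  x y z = ⊥-elim (y refl refl)
    at-most-one₃ true  false false x y z = ≤-refl
    at-most-one₃ false true  true  x y z = ⊥-elim (z refl refl)
    at-most-one₃ false true  false x y z = ≤-refl
    at-most-one₃ false false true  x y z = ≤-refl
    at-most-one₃ false false false x y z = z≤n

    at-most-one₄ : ∀ a b c d → (a ≡ true → b ≡ true → ⊥) → (a ≡ true → c ≡ true → ⊥) →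
                   (a ≡ true → d ≡ true → ⊥) → (b ≡ true → c ≡ true → ⊥) →
                   (b ≡ true → d ≡ true → ⊥) → (c ≡ true → d ≡ true → ⊥) →
                   ⟦ a ⟧ + (⟦ b ⟧ + (⟦ c ⟧ + ⟦ d ⟧)) ≤ 1
    at-most-one₄ false b c d ab ac ad bc bd cd = at-most-one₃ b c d bc bd cd
    at-most-one₄ true true c d ab ac ad bc bd cd = ⊥-elim (ab refl refl)
    at-most-one₄ true false true d ab ac ad bc bd cd = ⊥-elim (ac refl refl)
    at-most-one₄ true false false true ab ac ad bc bd cd = ⊥-elim (ad refl refl)
    at-most-one₄ true false false false ab ac ad bc bd cd = ≤-refl

    triangle-reps large-reps : Fin n × Fin n → ℕ
    triangle-reps d = if triangle d then ⟦ rep d ⟧ else 0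
    large-reps d = if triangle d then 0 else ⟦ rep d ⟧

    -- Averaging replaces an enumeration of faces: `φ` preserves dart sums, so three copies of the
    -- sum are taken along three successive darts, at most one of which is a representative.
    triangles : 3 * dartSum triangle-reps ≤ dartSum (λ d → ⟦ triangle d ⟧)
    triangles = begin
      3 * dartSum triangle-reps
        ≡⟨ cong (A +_) (cong₂ _+_ (≡.sym s₁) (≡.trans (+-identityʳ _) (≡.sym s₂))) ⟩
      dartSum triangle-reps +
        (dartSum (triangle-reps ∘ φ′) + dartSum (triangle-reps ∘ φ′ ∘ φ′))
        ≡⟨ ≡.sym (≡.trans (dartSum-+ _ _) (cong (dartSum triangle-reps +_) (dartSum-+ _ _))) ⟩
      dartSum (λ d → triangle-reps d + (triangle-reps (φ′ d) + triangle-reps (φ′ (φ′ d))))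
        ≤⟨ dartSum-mono pointwise ⟩
      dartSum (λ d → ⟦ triangle d ⟧) ∎
      where
      open ≤-Reasoning
      A = dartSum triangle-reps
      s₁ : dartSum (triangle-reps ∘ φ′) ≡ dartSum triangle-reps
      s₁ = dartSum-φ triangle-reps
      s₂ : dartSum (triangle-reps ∘ φ′ ∘ φ′) ≡ dartSum triangle-reps
      s₂ = ≡.trans (dartSum-φ (triangle-reps ∘ φ′)) s₁
      pointwise : ∀ d → Dart d →
        triangle-reps d + (triangle-reps (φ′ d) + triangle-reps (φ′ (φ′ d))) ≤ ⟦ triangle d ⟧
      pointwise d a rewrite triangle-φ (φ′ d) (φ-dart d a) | triangle-φ d a
        with triangle d in t
      ... | false = z≤n
      ... | true  = at-most-one₃ (rep d) (rep (φ′ d)) (rep (φ′ (φ′ d)))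
              (rep-triangle d a t 1 2 refl (φ≢ d a))
              (rep-triangle d a t 2 1 refl (φ²≢ d a))
              (rep-triangle (φ′ d) (φ-dart d a) (≡.trans (triangle-φ d a) t) 1 2 refl
                (φ≢ _ (φ-dart d a)))

    -- The same averaging over four successive darts, which are distinct on a face of length at
    -- least 4.
    large-faces : 4 * dartSum large-reps ≤ dartSum (λ d → ⟦ not (triangle d) ⟧)
    large-faces = begin
      4 * dartSum large-reps
        ≡⟨ cong (A +_) (cong₂ _+_ (≡.sym s₁)
             (cong₂ _+_ (≡.sym s₂) (≡.trans (+-identityʳ _) (≡.sym s₃)))) ⟩
      dartSum large-reps + (dartSum (large-reps ∘ φ′) +
        (dartSum (large-reps ∘ φ′ ∘ φ′) + dartSum (large-reps ∘ φ′ ∘ φ′ ∘ φ′)))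
        ≡⟨ ≡.sym (≡.trans (dartSum-+ _ _) (cong (dartSum large-reps +_)
             (≡.trans (dartSum-+ _ _) (cong (dartSum (large-reps ∘ φ′) +_) (dartSum-+ _ _))))) ⟩
      dartSum (λ d → large-reps d + (large-reps (φ′ d) +
        (large-reps (φ′ (φ′ d)) + large-reps (φ′ (φ′ (φ′ d))))))
        ≤⟨ dartSum-mono pointwise ⟩
      dartSum (λ d → ⟦ not (triangle d) ⟧) ∎
      where
      open ≤-Reasoning
      A = dartSum large-reps
      s₁ : dartSum (large-reps ∘ φ′) ≡ dartSum large-reps
      s₁ = dartSum-φ large-reps
      s₂ : dartSum (large-reps ∘ φ′ ∘ φ′) ≡ dartSum large-reps
      s₂ = ≡.trans (dartSum-φ (large-reps ∘ φ′)) s₁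
      s₃ : dartSum (large-reps ∘ φ′ ∘ φ′ ∘ φ′) ≡ dartSum large-reps
      s₃ = ≡.trans (dartSum-φ (large-reps ∘ φ′ ∘ φ′)) s₂
      pointwise : ∀ d → Dart d →
        large-reps d + (large-reps (φ′ d) +
          (large-reps (φ′ (φ′ d)) + large-reps (φ′ (φ′ (φ′ d))))) ≤ ⟦ not (triangle d) ⟧
      pointwise d a
        rewrite triangle-φ (φ′ (φ′ d)) (φ^-dart 2 a) | triangle-φ (φ′ d) (φ-dart d a) | triangle-φ d a
        with triangle d in t
      ... | true  = z≤n
      ... | false = at-most-one₄ (rep d) (rep (φ′ d)) (rep (φ′ (φ′ d))) (rep (φ′ (φ′ (φ′ d))))
              (rep-large d a t 0 (s≤s z≤n)) (rep-large d a t 1 (s≤s (s≤s z≤n)))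
              (rep-large d a t 2 ≤-refl)
              (rep-large (φ′ d) a₁ t₁ 0 (s≤s z≤n)) (rep-large (φ′ d) a₁ t₁ 1 (s≤s (s≤s z≤n)))
              (rep-large (φ′ (φ′ d)) (φ^-dart 2 a) (≡.trans (triangle-φ _ a₁) t₁) 0 (s≤s z≤n))
        where
        a₁ = φ-dart d a
        t₁ = ≡.trans (triangle-φ d a) t

    faces-split : faces G R ≡ dartSum triangle-reps + dartSum large-reps
    faces-split = ≡.trans (sumF-cong λ u → sumF-cong λ v → split (adj G u v) (rep (u , v)) (triangle (u , v)))
                          (dartSum-+ triangle-reps large-reps)
      where
      split : ∀ a r t → ⟦ a ∧ r ⟧ ≡
              (if a then (if t then ⟦ r ⟧ else 0) + (if t then 0 else ⟦ r ⟧) else 0)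
      split false r t     = refl
      split true  r true  = ≡.sym (+-identityʳ _)
      split true  r false = refl

    -- A dart accounts for at most a third of a face in a triangle and at most a quarter elsewhere.
    faces-bound : 12 * faces G R ≤
                  4 * dartSum (λ d → ⟦ triangle d ⟧) + 3 * dartSum (λ d → ⟦ not (triangle d) ⟧)
    faces-bound = begin
      12 * faces G R                           ≡⟨ cong (12 *_) faces-split ⟩
      12 * (dartSum triangle-reps + dartSum large-reps)
        ≡⟨ *-distribˡ-+ 12 (dartSum triangle-reps) (dartSum large-reps) ⟩
      12 * dartSum triangle-reps + 12 * dartSum large-reps
        ≡⟨ cong₂ _+_ (*-assoc 4 3 (dartSum triangle-reps)) (*-assoc 3 4 (dartSum large-reps)) ⟩
      4 * (3 * dartSum triangle-reps) + 3 * (4 * dartSum large-reps)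
        ≤⟨ +-mono-≤ (*-monoʳ-≤ 4 triangles) (*-monoʳ-≤ 3 large-faces) ⟩
      4 * dartSum (λ d → ⟦ triangle d ⟧) + 3 * dartSum (λ d → ⟦ not (triangle d) ⟧) ∎
      where open ≤-Reasoning

-- The local inequality at a 5-vertex

-- A vertex of degree d ≥ 7 sends 2 ρ(min d 16) ≤ 240 (d − 6) / d through each of its corners.
ρ : ℕ → ℕ
ρ 7  = 17
ρ 8  = 30
ρ 9  = 40
ρ 10 = 48
ρ 11 = 54
ρ 12 = 60
ρ 13 = 64
ρ 14 = 68
ρ 15 = 72
ρ 16 = 75
ρ _  = 0

-- What a 5-vertex gets through a corner at w whose other neighbour has degree u.
share : ℕ → ℕ → ℕ
share w u = if u ≡ᵇ 5 then ρ w else 2 * ρ w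

-- For a neighbour a of a 5-vertex v, the degrees x, y of the two vertices following a on one side
-- around v.  If x = 5 and the faces are triangles, y is the degree of the apex of the triangle on
-- the edge vx opposite to a: D and S stand for a big apex and for one of degree 5.
data Side : Set where
  S D O : Side

side : ℕ → ℕ → Side
side x y = if x ≡ᵇ 5 then (if y ≡ᵇ 5 then S else if 16 ≤ᵇ y then D else O) else O

-- The cyclic neighbourhoods 9, 5, D, 5, 5: the only ones receiving less than 240.
poor : Side → Side → Bool
poor S D = true
poor D S = true
poor _ _ = false

-- Surplus that a 5-vertex which is not poor can give up to each of its 9-neighbours.
credit : Side → Side → ℕ
credit S _ = 80
credit _ S = 80
credit D D = 80
credit D O = 30
credit O D = 30
credit O O = 0

pay : Bool → Side → Side → ℕ
pay t r l = if t ∧ poor r l then 0 else credit r l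

debt : Bool → Side → Side → ℕ
debt t r l = if t ∧ poor r l then 10 else 0

at9 : ℕ → ℕ → ℕ
at9 a x = if a ≡ᵇ 9 then x else 0

-- The trailing 0 gives this the shape of an unfolded `sumF` over `Fin 5`.
cyclic : (ℕ → ℕ → ℕ → ℕ → ℕ → ℕ) → ℕ → ℕ → ℕ → ℕ → ℕ → ℕ
cyclic f a b c d e = f a b c d e + (f b c d e a + (f c d e a b + (f d e a b c + (f e a b c d + 0))))

pays debts : Bool → ℕ → ℕ → ℕ → ℕ → ℕ → ℕ
pays  t = cyclic λ a b c d e → at9 a (pay t (side b c) (side e d))
debts t = cyclic λ a b c d e → at9 a (debt t (side b c) (side e d))

-- Meant for a 5-vertex with only triangles around it: the two corners through which `a` sends
-- charge then have `b` and `e` as their other ends.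
gain : ℕ → ℕ → ℕ → ℕ → ℕ → ℕ
gain = cyclic λ a b c d e → share a b + share a e

-- A lower bound whatever the faces are, as `share` is never below `ρ`.
baseGain : ℕ → ℕ → ℕ → ℕ → ℕ → ℕ
baseGain = cyclic λ a b c d e → ρ a + ρ a

rest total : ℕ → ℕ → ℕ → ℕ → ℕ → ℕ
total = cyclic λ a b c d e → a
rest a b c d e = b + (c + (d + e))

-- Excludes the tuples that cannot come from a heavy star. There the neighbours have degree sum at
-- least Δ + 24, so any four of them have at least 24; truncation keeps this bound and leaves a
-- total of at least 40 = 16 + 24.
light : ℕ → ℕ → ℕ → ℕ → ℕ → Bool
light a b c d e = (total a b c d e <ᵇ 40) ∨ (rest a b c d e <ᵇ 24) ∨ (rest b c d e a <ᵇ 24) ∨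
  (rest c d e a b <ᵇ 24) ∨ (rest d e a b c <ᵇ 24) ∨ (rest e a b c d <ᵇ 24)

-- The first inequality is for a centre surrounded by triangles, the second for one with a corner in
-- a longer face, which contributes the 120.
leaf : ℕ → ℕ → ℕ → ℕ → ℕ → Bool
leaf a b c d e = light a b c d e ∨
  ((240 + pays true a b c d e ≤ᵇ gain a b c d e + debts true a b c d e) ∧
   (240 + pays false a b c d e ≤ᵇ 120 + baseGain a b c d e))

-- Exhaustive check of the local inequality

allFrom : ℕ → ℕ → (ℕ → Bool) → Bool
allFrom lo zero    p = true
allFrom lo (suc k) p = p lo ∧ allFrom (suc lo) k p

all₅₋₁₆ : (ℕ → Bool) → Bool
all₅₋₁₆ = allFrom 5 12

allFrom-sound : ∀ lo k p → allFrom lo k p ≡ true → ∀ i → lo ≤ i → i < lo + k → p i ≡ true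
allFrom-sound lo zero    p h i l u =
  ⊥-elim (<-irrefl refl (<-≤-trans u (≤-trans (≤-reflexive (+-identityʳ lo)) l)))
allFrom-sound lo (suc k) p h i l u with p lo in e | m≤n⇒m<n∨m≡n l
... | true | inj₂ refl = e
... | true | inj₁ lo<i = allFrom-sound (suc lo) k p h i lo<i (subst (i <_) (+-suc lo k) u)

leaf₄ : ℕ → ℕ → ℕ → ℕ → Bool
leaf₄ a b c d = all₅₋₁₆ (leaf a b c d)

leaf₃ : ℕ → ℕ → ℕ → Bool
leaf₃ a b c = all₅₋₁₆ (leaf₄ a b c)

leaf₂ : ℕ → ℕ → Bool
leaf₂ a b = all₅₋₁₆ (leaf₃ a b)

leaf₁ : ℕ → Bool
leaf₁ a = all₅₋₁₆ (leaf₂ a)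

-- Proved by evaluation over all 12^5 tuples of truncated degrees.
search : all₅₋₁₆ leaf₁ ≡ true
search = refl

all-sound : ∀ p → all₅₋₁₆ p ≡ true → ∀ i → 5 ≤ i × i ≤ 16 → p i ≡ true
all-sound p h i (l , u) = allFrom-sound 5 12 p h i l (s≤s u)

leaf-true : ∀ a b c d e → 5 ≤ a × a ≤ 16 → 5 ≤ b × b ≤ 16 → 5 ≤ c × c ≤ 16 →
            5 ≤ d × d ≤ 16 → 5 ≤ e × e ≤ 16 → leaf a b c d e ≡ true
leaf-true a b c d e ha hb hc hd he =
  all-sound (leaf a b c d) (all-sound (leaf₄ a b c) (all-sound (leaf₃ a b)
    (all-sound (leaf₂ a) (all-sound leaf₁ search a ha) b hb) c hc) d hd) e he

≥⇒<ᵇ : ∀ {m k} → k ≤ m → (m <ᵇ k) ≡ false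
≥⇒<ᵇ {m} {k} k≤m with m <ᵇ k in e
... | false = refl
... | true  = ⊥-elim (<⇒≱ (<ᵇ⇒< m k (subst T (≡.sym e) _)) k≤m)

∧-≤ᵇ : ∀ a b c d → (a ≤ᵇ b) ∧ (c ≤ᵇ d) ≡ true → a ≤ b × c ≤ d
∧-≤ᵇ a b c d h with a ≤ᵇ b in p | c ≤ᵇ d in q
... | true | true = ≤ᵇ⇒≤ a b (subst T (≡.sym p) _) , ≤ᵇ⇒≤ c d (subst T (≡.sym q) _)

Fits : ℕ → ℕ → ℕ → ℕ → ℕ → Set
Fits a b c d e = 40 ≤ total a b c d e × 24 ≤ rest a b c d e × 24 ≤ rest b c d e a ×
  24 ≤ rest c d e a b × 24 ≤ rest d e a b c × 24 ≤ rest e a b c d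

not-light : ∀ a b c d e → Fits a b c d e → light a b c d e ≡ false
not-light a b c d e (p , q , r , s , t , u)
  rewrite ≥⇒<ᵇ p | ≥⇒<ᵇ q | ≥⇒<ᵇ r | ≥⇒<ᵇ s | ≥⇒<ᵇ t | ≥⇒<ᵇ u = refl

local-balance : ∀ a b c d e → 5 ≤ a × a ≤ 16 → 5 ≤ b × b ≤ 16 → 5 ≤ c × c ≤ 16 →
  5 ≤ d × d ≤ 16 → 5 ≤ e × e ≤ 16 → Fits a b c d e →
  240 + pays true a b c d e ≤ gain a b c d e + debts true a b c d e ×
  240 + pays false a b c d e ≤ 120 + baseGain a b c d e
local-balance a b c d e ha hb hc hd he f =
  ∧-≤ᵇ (240 + pays true a b c d e) (gain a b c d e + debts true a b c d e)
       (240 + pays false a b c d e) (120 + baseGain a b c d e)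
    (≡.trans (cong (_∨ ((240 + pays true a b c d e ≤ᵇ gain a b c d e + debts true a b c d e) ∧
                        (240 + pays false a b c d e ≤ᵇ 120 + baseGain a b c d e)))
                   (≡.sym (not-light a b c d e f)))
             (leaf-true a b c d e ha hb hc hd he))

-- Truncating degrees at 16

cap : ℕ → ℕ
cap d = d ⊓ 16

cap-cases : ∀ d → cap d ≡ d ⊎ cap d ≡ 16
cap-cases d with ⊓-sel d 16
... | inj₁ e = inj₁ e
... | inj₂ e = inj₂ e

cap-bounds : ∀ {d} → 5 ≤ d → 5 ≤ cap d × cap d ≤ 16
cap-bounds {d} 5≤d = ⊓-glb 5≤d (≤ᵇ⇒≤ 5 16 _) , m⊓n≤n d 16

cap-≡ : ∀ {d k} → k < 16 → cap d ≡ k → d ≡ k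
cap-≡ {d} k<16 e with cap-cases d
... | inj₁ f = ≡.trans (≡.sym f) e
... | inj₂ f = ⊥-elim (<-irrefl (≡.trans (≡.sym e) f) k<16)

cap-≥5 : ∀ {d} → 5 ≤ d → 5 ≤ cap d
cap-≥5 h = proj₁ (cap-bounds h)

-- A single entry truncated to 16 already gives 16 + 5 + 5 + 5 = 31; otherwise nothing changes.
cap-rest : ∀ a {b c d e} → 5 ≤ b → 5 ≤ c → 5 ≤ d → 5 ≤ e →
           24 ≤ rest a b c d e → 24 ≤ rest a (cap b) (cap c) (cap d) (cap e)
cap-rest _ {b} {c} {d} {e} hb hc hd he h
  with cap-cases b | cap-cases c | cap-cases d | cap-cases e
... | inj₂ p | _ | _ | _ rewrite p =
  ≤-trans (≤ᵇ⇒≤ 24 31 _) (+-monoʳ-≤ 16 (+-mono-≤ (cap-≥5 hc) (+-mono-≤ (cap-≥5 hd) (cap-≥5 he))))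
... | inj₁ _ | inj₂ p | _ | _ rewrite p =
  ≤-trans (≤ᵇ⇒≤ 24 31 _) (+-mono-≤ (cap-≥5 hb) (+-monoʳ-≤ 16 (+-mono-≤ (cap-≥5 hd) (cap-≥5 he))))
... | inj₁ _ | inj₁ _ | inj₂ p | _ rewrite p =
  ≤-trans (≤ᵇ⇒≤ 24 31 _) (+-mono-≤ (cap-≥5 hb) (+-mono-≤ (cap-≥5 hc) (+-monoʳ-≤ 16 (cap-≥5 he))))
... | inj₁ _ | inj₁ _ | inj₁ _ | inj₂ p rewrite p =
  ≤-trans (≤ᵇ⇒≤ 24 31 _) (+-mono-≤ (cap-≥5 hb) (+-mono-≤ (cap-≥5 hc) (+-monoˡ-≤ 16 (cap-≥5 hd))))
... | inj₁ p | inj₁ q | inj₁ r | inj₁ s rewrite p | q | r | s = h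

total-rotate : ∀ a b c d e → total a b c d e ≡ total b c d e a
total-rotate = rotate
  where
  rotate : ∀ a b c d e → a + (b + (c + (d + (e + 0)))) ≡ b + (c + (d + (e + (a + 0))))
  rotate = solve-∀

total-rest : ∀ a b c d e → total a b c d e ≡ a + rest a b c d e
total-rest a b c d e = cong (λ z → a + (b + (c + (d + z)))) (+-identityʳ e)

module Capped (Δ : ℕ) (16≤Δ : 16 ≤ Δ) where

  Bounded : ℕ → Set
  Bounded d = 5 ≤ d × d ≤ Δ

  private
    rest≥24 : ∀ {a b c d e} → Bounded a → Bounded b → Bounded c → Bounded d → Bounded e →
              Δ + 24 ≤ total a b c d e → 24 ≤ rest (cap a) (cap b) (cap c) (cap d) (cap e)
    rest≥24 {a} {b} {c} {d} {e} ha hb hc hd he h =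
      cap-rest (cap a) (proj₁ hb) (proj₁ hc) (proj₁ hd) (proj₁ he)
        (+-cancelˡ-≤ Δ 24 _ (≤-trans h (≤-trans (≤-reflexive (total-rest a b c d e))
          (+-monoˡ-≤ (rest a b c d e) (proj₂ ha)))))

    first-capped : ∀ a b c d e → cap a ≡ 16 → 24 ≤ rest (cap a) (cap b) (cap c) (cap d) (cap e) →
                   40 ≤ total (cap a) (cap b) (cap c) (cap d) (cap e)
    first-capped a b c d e p h =
      subst (40 ≤_) (≡.sym (total-rest (cap a) (cap b) (cap c) (cap d) (cap e)))
        (+-mono-≤ (≤-reflexive (≡.sym p)) h)

  -- If some entry becomes 16, the other four add at least 24; if none changes, the total is still
  -- at least Δ + 24, hence at least 40.
  cap-fits : ∀ a b c d e → Bounded a → Bounded b → Bounded c → Bounded d → Bounded e →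
             Δ + 24 ≤ total a b c d e → Fits (cap a) (cap b) (cap c) (cap d) (cap e)
  cap-fits a b c d e ha hb hc hd he h₁ = total≥40 , r₁ , r₂ , r₃ , r₄ , r₅
    where
    h₂ = subst (Δ + 24 ≤_) (total-rotate a b c d e) h₁
    h₃ = subst (Δ + 24 ≤_) (total-rotate b c d e a) h₂
    h₄ = subst (Δ + 24 ≤_) (total-rotate c d e a b) h₃
    h₅ = subst (Δ + 24 ≤_) (total-rotate d e a b c) h₄
    r₁ = rest≥24 ha hb hc hd he h₁
    r₂ = rest≥24 hb hc hd he ha h₂
    r₃ = rest≥24 hc hd he ha hb h₃
    r₄ = rest≥24 hd he ha hb hc h₄
    r₅ = rest≥24 he ha hb hc hd h₅
    back : ∀ a b c d e → 40 ≤ total b c d e a → 40 ≤ total a b c d e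
    back a b c d e = subst (40 ≤_) (≡.sym (total-rotate a b c d e))
    A = cap a
    B = cap b
    C = cap c
    D′ = cap d
    E = cap e
    total≥40 : 40 ≤ total A B C D′ E
    total≥40 with cap-cases a | cap-cases b | cap-cases c | cap-cases d | cap-cases e
    ... | inj₂ p | _ | _ | _ | _ = first-capped a b c d e p r₁
    ... | _ | inj₂ p | _ | _ | _ = back A B C D′ E (first-capped b c d e a p r₂)
    ... | _ | _ | inj₂ p | _ | _ = back A B C D′ E (back B C D′ E A (first-capped c d e a b p r₃))
    ... | _ | _ | _ | inj₂ p | _ =
      back A B C D′ E (back B C D′ E A (back C D′ E A B (first-capped d e a b c p r₄)))
    ... | _ | _ | _ | _ | inj₂ p =
      back A B C D′ E (back B C D′ E A (back C D′ E A B (back D′ E A B C (first-capped e a b c d p r₅))))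
    ... | inj₁ p | inj₁ q | inj₁ r | inj₁ s | inj₁ t rewrite p | q | r | s | t =
      ≤-trans (+-monoˡ-≤ 24 16≤Δ) h₁

-- Runs of poor vertices around a 9-vertex

data State : Set where
  none DS SD : State

state : Bool → Side → Side → State
state true D S = DS
state true S D = SD
state _    _ _ = none

-- The edge joining two consecutive neighbours of the 9-vertex has one apex, so a poor neighbour
-- determines the facing side of the next and of the previous one.
forcedR forcedL : State → Side
forcedR none = O
forcedR DS   = S
forcedR SD   = D
forcedL none = O
forcedL DS   = D
forcedL SD   = S

minPay : State → State → State → ℕ
minPay p none q = credit (forcedR p) (forcedL q)
minPay _ _    _ = 0

cost : State → ℕ
cost none = 0
cost _    = 10

clash : State → State → Bool
clash DS DS = true
clash SD SD = true
clash _  _  = false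

same : State → State → Bool
same none none = true
same DS   DS   = true
same SD   SD   = true
same _    _    = false

same-refl : ∀ s → same s s ≡ true
same-refl none = refl
same-refl DS   = refl
same-refl SD   = refl

-- Enumerates the closed sequences of states without clashes; a, b are the first two states, p, q the
-- current two, x and y the pay and the cost collected so far.
walk : ℕ → State → State → State → State → ℕ → ℕ → Bool
extend : ℕ → State → State → State → State → ℕ → ℕ → State → Bool
walk zero    a b p q x y = not (same p a ∧ same q b) ∨ (y ≤ᵇ x)
walk (suc k) a b p q x y =
  extend k a b p q x y none ∧ (extend k a b p q x y DS ∧ extend k a b p q x y SD)
extend k a b p q x y s = clash q s ∨ walk k a b q s (x + minPay p q s) (y + cost q)

walk-extend : ∀ k a b p q x y → walk (suc k) a b p q x y ≡ true → ∀ s →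
              extend k a b p q x y s ≡ true
walk-extend k a b p q x y h s
  with extend k a b p q x y none in e₁ | extend k a b p q x y DS in e₂ | extend k a b p q x y SD in e₃
walk-extend k a b p q x y h none | true | true | true = e₁
walk-extend k a b p q x y h DS   | true | true | true = e₂
walk-extend k a b p q x y h SD   | true | true | true = e₃

-- In the induction `c` is shifted while `a` and `b` stay, so that the closing condition keeps
-- referring to the original first two states.
walk-sound : ∀ k a b (c : ℕ → State) x y → walk k a b (c 0) (c 1) x y ≡ true →
  c k ≡ a → c (suc k) ≡ b → (∀ i → clash (c i) (c (suc i)) ≡ false) →
  y + sumF {k} (λ i → cost (c (suc (toℕ i)))) ≤
  x + sumF {k} (λ i → minPay (c (toℕ i)) (c (suc (toℕ i))) (c (suc (suc (toℕ i)))))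
walk-sound zero a b c x y h refl refl ok
  rewrite same-refl (c 0) | same-refl (c 1) | +-identityʳ x | +-identityʳ y =
  ≤ᵇ⇒≤ y x (subst T (≡.sym h) _)
walk-sound (suc k) a b c x y h e f ok =
  subst₂ _≤_ (+-assoc y _ _) (+-assoc x _ _)
    (walk-sound k a b (c ∘ suc) (x + minPay (c 0) (c 1) (c 2)) (y + cost (c 1)) step e f (ok ∘ suc))
  where
  step : walk k a b (c 1) (c 2) (x + minPay (c 0) (c 1) (c 2)) (y + cost (c 1)) ≡ true
  step = ≡.trans (cong (_∨ walk k a b (c 1) (c 2) (x + minPay (c 0) (c 1) (c 2)) (y + cost (c 1)))
                   (≡.sym (ok 1)))
           (walk-extend k a b (c 0) (c 1) x y h (c 2))

-- Poor states alternate along a run, so with 9 odd at most 8 are poor and the cost is at most 80.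
-- If a vertex outside the runs has a forced side `S`, its 80 suffices. Otherwise every run shows
-- `D` at both ends and is even: length 8 leaves one vertex with `D` on both sides, paying 80, and a
-- run of length at most 6 gets 30 from each end, as `credit D D` covers two such payments.
walk-nine : ∀ a b → walk 9 a b a b 0 0 ≡ true
walk-nine none none = refl
walk-nine none DS = refl
walk-nine none SD = refl
walk-nine DS none = refl
walk-nine DS DS = refl
walk-nine DS SD = refl
walk-nine SD none = refl
walk-nine SD DS = refl
walk-nine SD SD = refl

-- The discharging rules on the graph

term≤sumF : ∀ {n} (f : Fin n → ℕ) i → f i ≤ sumF f
term≤sumF f F.zero    = m≤m+n (f F.zero) _
term≤sumF f (F.suc i) = ≤-trans (term≤sumF (f ∘ F.suc) i) (m≤n+m _ (f F.zero))

≡ᵇ-true : ∀ {m k} → m ≡ k → (m ≡ᵇ k) ≡ true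
≡ᵇ-true {m} {k} e with m ≡ᵇ k in q
... | true  = refl
... | false = ⊥-elim (subst T q (≡⇒≡ᵇ m k e))

≡ᵇ-sound : ∀ {m k} → (m ≡ᵇ k) ≡ true → m ≡ k
≡ᵇ-sound {m} {k} e = ≡ᵇ⇒≡ m k (subst T (≡.sym e) _)

cyclic-fold : ∀ f (g : ℕ → ℕ) → g 5 ≡ g 0 → g 6 ≡ g 1 → g 7 ≡ g 2 → g 8 ≡ g 3 →
  f (g 0) (g 1) (g 2) (g 3) (g 4) + (f (g 1) (g 2) (g 3) (g 4) (g 5) +
  (f (g 2) (g 3) (g 4) (g 5) (g 6) + (f (g 3) (g 4) (g 5) (g 6) (g 7) +
  (f (g 4) (g 5) (g 6) (g 7) (g 8) + 0)))) ≡ cyclic f (g 0) (g 1) (g 2) (g 3) (g 4)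
cyclic-fold f g p q r s rewrite p | q | r | s = refl

share≥ρ : ∀ w u → ρ w ≤ share w u
share≥ρ w u with u ≡ᵇ 5
... | true  = ≤-refl
... | false = m≤m+n (ρ w) _

side≢O : ∀ x y → side x y ≢ O → x ≡ 5
side≢O x y ne with x ≡ᵇ 5 in e
... | true  = ≡ᵇ-sound e
... | false = ⊥-elim (ne refl)

state-true : ∀ b r l → state b r l ≢ none → b ≡ true × r ≢ O × l ≢ O
state-true true D S ne = refl , (λ ()) , (λ ())
state-true true S D ne = refl , (λ ()) , (λ ())
state-true true S S ne = ⊥-elim (ne refl)
state-true true S O ne = ⊥-elim (ne refl)
state-true true D D ne = ⊥-elim (ne refl)
state-true true D O ne = ⊥-elim (ne refl)
state-true true O l ne = ⊥-elim (ne refl)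
state-true false r l ne = ⊥-elim (ne refl)

state-sides : ∀ b r l → state b r l ≢ none →
              forcedR (state b r l) ≡ l × forcedL (state b r l) ≡ r
state-sides true D S ne = refl , refl
state-sides true S D ne = refl , refl
state-sides true S S ne = ⊥-elim (ne refl)
state-sides true S O ne = ⊥-elim (ne refl)
state-sides true D D ne = ⊥-elim (ne refl)
state-sides true D O ne = ⊥-elim (ne refl)
state-sides true O l ne = ⊥-elim (ne refl)
state-sides false r l ne = ⊥-elim (ne refl)

clash-sides : ∀ s b r l → (s ≢ none → forcedR s ≡ r) → clash s (state b r l) ≡ false
clash-sides none b r l h = refl
clash-sides DS b r l h with h (λ ())
clash-sides DS true  S S h | refl = refl
clash-sides DS true  S D h | refl = refl
clash-sides DS true  S O h | refl = refl
clash-sides DS false S l h | refl = refl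
clash-sides SD b r l h with h (λ ())
clash-sides SD true  D S h | refl = refl
clash-sides SD true  D D h | refl = refl
clash-sides SD true  D O h | refl = refl
clash-sides SD false D l h | refl = refl

credit-O : ∀ r l → credit O l ≤ credit r l
credit-O S S = ≤-refl
credit-O S D = ≤ᵇ⇒≤ 30 80 _
credit-O S O = z≤n
credit-O D S = ≤-refl
credit-O D D = ≤ᵇ⇒≤ 30 80 _
credit-O D O = z≤n
credit-O O l = ≤-refl

credit-comm : ∀ r l → credit r l ≡ credit l r
credit-comm S S = refl
credit-comm S D = refl
credit-comm S O = refl
credit-comm D S = refl
credit-comm D D = refl
credit-comm D O = refl
credit-comm O S = refl
credit-comm O D = refl
credit-comm O O = refl

-- `minPay` puts `O` where nothing is forced, so `credit` must not drop when the actual side is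
-- inserted.
credit-mono : ∀ {r r′ l l′} → r ≡ O ⊎ r ≡ r′ → l ≡ O ⊎ l ≡ l′ → credit r l ≤ credit r′ l′
credit-mono {r} {r′} {l} {l′} p q =
  ≤-trans (left p) (subst₂ _≤_ (credit-comm l r′) (credit-comm l′ r′) (right q))
  where
  left : r ≡ O ⊎ r ≡ r′ → credit r l ≤ credit r′ l
  left (inj₁ refl) = credit-O r′ l
  left (inj₂ refl) = ≤-refl
  right : l ≡ O ⊎ l ≡ l′ → credit l r′ ≤ credit l′ r′
  right (inj₁ refl) = credit-O l′ r′
  right (inj₂ refl) = ≤-refl

due : Side → Side → State → ℕ
due r l none = credit r l
due r l _    = 0

due-≤ : ∀ c r l → due r l (state c r l) ≤ pay c r l
due-≤ false r l = ≤-refl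
due-≤ true  S S = ≤-refl
due-≤ true  S D = z≤n
due-≤ true  S O = ≤-refl
due-≤ true  D S = z≤n
due-≤ true  D D = ≤-refl
due-≤ true  D O = ≤-refl
due-≤ true  O l = ≤-refl

-- A poor neighbour on either side forces degree 5, that is `f ≡ true`. Hence for `f` false both are
-- `none`, and `credit O O` is 0.
minPay-≤ : ∀ p q f c r l → (p ≢ none → forcedR p ≡ r × f ≡ true) →
           (q ≢ none → forcedL q ≡ l × f ≡ true) →
           minPay p (state (f ∧ c) r l) q ≤ (if f then pay c r l else 0)
minPay-≤ none none false c r l hp hq = z≤n
minPay-≤ none DS   false c r l hp hq with hq (λ ())
... | _ , ()
minPay-≤ none SD   false c r l hp hq with hq (λ ())
... | _ , ()
minPay-≤ DS   q    false c r l hp hq with hp (λ ())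
... | _ , ()
minPay-≤ SD   q    false c r l hp hq with hp (λ ())
... | _ , ()
minPay-≤ p    q    true  c r l hp hq = ≤-trans unpoor (due-≤ c r l)
  where
  forcedR-≡ : ∀ p → (p ≢ none → forcedR p ≡ r × true ≡ true) → forcedR p ≡ O ⊎ forcedR p ≡ r
  forcedR-≡ none h = inj₁ refl
  forcedR-≡ DS   h = inj₂ (proj₁ (h (λ ())))
  forcedR-≡ SD   h = inj₂ (proj₁ (h (λ ())))
  forcedL-≡ : ∀ q → (q ≢ none → forcedL q ≡ l × true ≡ true) → forcedL q ≡ O ⊎ forcedL q ≡ l
  forcedL-≡ none h = inj₁ refl
  forcedL-≡ DS   h = inj₂ (proj₁ (h (λ ())))
  forcedL-≡ SD   h = inj₂ (proj₁ (h (λ ())))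
  unpoor : minPay p (state c r l) q ≤ due r l (state c r l)
  unpoor with state c r l
  ... | none = credit-mono (forcedR-≡ p hp) (forcedL-≡ q hq)
  ... | DS   = z≤n
  ... | SD   = z≤n

debt-≤ : ∀ f c r l → (if f then debt c r l else 0) ≤ cost (state (f ∧ c) r l)
debt-≤ false c     r l = z≤n
debt-≤ true  false r l = z≤n
debt-≤ true  true  S S = z≤n
debt-≤ true  true  S D = ≤-refl
debt-≤ true  true  S O = z≤n
debt-≤ true  true  D S = ≤-refl
debt-≤ true  true  D D = z≤n
debt-≤ true  true  D O = z≤n
debt-≤ true  true  O l = z≤n

module Discharge {n} (G : Graph n) (R : Rotation G) (deg≥5 : ∀ v → 5 ≤ deg G v) where
  open Rot G R public

  nbrSum-mono : ∀ v {f g} → (∀ u → adj G v u ≡ true → f u ≤ g u) → nbrSum v f ≤ nbrSum v g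
  nbrSum-mono v h = sumF-mono λ u → if-mono (adj G v u) (h u)

  term≤nbrSum : ∀ v f {u} → adj G v u ≡ true → f u ≤ nbrSum v f
  term≤nbrSum v f {u} a = subst (λ b → (if b then f u else 0) ≤ nbrSum v f) a
    (term≤sumF (λ u → if adj G v u then f u else 0) u)

  -- A power of `rot v` serves as its inverse, because the period on neighbours is `deg G v`.
  rot⁻ : Fin n → Fin n → Fin n
  rot⁻ v u = iter (rot v) (deg G v ∸ 1) u

  rot-rot⁻ : ∀ v u → adj G v u ≡ true → rot v (rot⁻ v u) ≡ u
  rot-rot⁻ v u a = ≡.trans
    (cong (λ k → iter (rot v) k u) (m+[n∸m]≡n (≤-trans (s≤s z≤n) (deg≥5 v))))
    (C.Orbit.period v u a)

  rot⁻-rot : ∀ v u → adj G v u ≡ true → rot⁻ v (rot v u) ≡ u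
  rot⁻-rot v u a = ≡.trans (iter-suc (rot v) (deg G v ∸ 1) u) (rot-rot⁻ v u a)

  rot⁻-adj : ∀ v u → adj G v u ≡ true → adj G v (rot⁻ v u) ≡ true
  rot⁻-adj v u a = C.iter-closed v (deg G v ∸ 1) a

  period₅ : ∀ v u → adj G v u ≡ true → deg G v ≡ 5 → iter (rot v) 5 u ≡ u
  period₅ v u a d = subst (λ k → iter (rot v) k u ≡ u) d (C.Orbit.period v u a)

  rot⁻₅ : ∀ v u → deg G v ≡ 5 → rot⁻ v u ≡ iter (rot v) 4 u
  rot⁻₅ v u d = cong (λ k → iter (rot v) (k ∸ 1) u) d

  nbrSum-cyclic : ∀ v x → adj G v x ≡ true → deg G v ≡ 5 → ∀ h f →
    nbrSum v (λ u → f (h u) (h (rot v u)) (h (iter (rot v) 2 u)) (h (iter (rot v) 3 u))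
                      (h (iter (rot v) 4 u)))
    ≡ cyclic f (h x) (h (rot v x)) (h (iter (rot v) 2 x)) (h (iter (rot v) 3 x))
               (h (iter (rot v) 4 x))
  nbrSum-cyclic v x a d h f = ≡.trans
    (subst (λ k → nbrSum v F ≡ sumF {k} (λ i → F (iter (rot v) (toℕ i) x))) d
      (C.Orbit.orbit-sum v x a F))
    (cyclic-fold f (λ k → h (iter (rot v) k x))
      (cong h p) (cong (h ∘ rot v) p) (cong (h ∘ iter (rot v) 2) p) (cong (h ∘ iter (rot v) 3) p))
    where
    p = period₅ v x a d
    F : Fin n → ℕ
    F u = f (h u) (h (rot v u)) (h (iter (rot v) 2 u)) (h (iter (rot v) 3 u)) (h (iter (rot v) 4 u))

  triangle-rot : ∀ u v → triangle (u , v) ≡ true →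
                 rot (rot v u) v ≡ u × rot u (rot v u) ≡ v
  triangle-rot u v t = p , ≡.trans (cong (λ z → rot z (rot v u)) (≡.sym p)) (cong proj₂ q)
    where
    q = triangle⇒ (u , v) t
    p = cong proj₁ q

  triangle-adj : ∀ {u v} → adj G v u ≡ true → triangle (u , v) ≡ true → adj G u (rot v u) ≡ true
  triangle-adj {u} {v} a t = adj-sym (subst (λ z → adj G (rot v u) z ≡ true)
    (proj₁ (triangle-rot u v t)) (φ^-dart 2 {u , v} (adj-sym a)))

  dg : Fin n → ℕ
  dg v = cap (deg G v)

  dg-bounds : ∀ v → 5 ≤ dg v × dg v ≤ 16
  dg-bounds v = cap-bounds (deg≥5 v)

  -- The charge sent by `w` to `u` through the corner at `w` between `u` and `u′`.
  κ : Fin n → Fin n → Fin n → ℕ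
  κ w u u′ = if dg u ≡ᵇ 5 then share (dg w) (dg u′) else 0

  large-corners : Fin n → ℕ
  large-corners v = nbrSum v (λ u → ⟦ not (triangle (u , v)) ⟧)

  recv : Fin n → Fin n → ℕ
  recv v w = κ w v (rot w v) + κ w v (rot⁻ w v)

  received : Fin n → ℕ
  received v = 120 * large-corners v + nbrSum v (recv v)

  calm : Fin n → Bool
  calm v = large-corners v ≡ᵇ 0

  sideR sideL : Fin n → Fin n → Side
  sideR v a = side (dg (rot v a)) (dg (iter (rot v) 2 a))
  sideL v a = side (dg (iter (rot v) 4 a)) (dg (iter (rot v) 3 a))

  payTo debtTo : Fin n → Fin n → ℕ
  payTo  v a = if dg v ≡ᵇ 5 then at9 (dg a) (pay  (calm v) (sideR v a) (sideL v a)) else 0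
  debtTo v a = if dg v ≡ᵇ 5 then at9 (dg a) (debt (calm v) (sideR v a) (sideL v a)) else 0

  calm-triangle : ∀ {v} → calm v ≡ true → ∀ u → adj G v u ≡ true → triangle (u , v) ≡ true
  calm-triangle {v} c u a with triangle (u , v) in t
  ... | true  = refl
  ... | false = ⊥-elim (<-irrefl (≡.sym (≡ᵇ-sound {large-corners v} c))
                  (subst (λ b → ⟦ not b ⟧ ≤ large-corners v) t (term≤nbrSum v (λ u → ⟦ not (triangle (u , v)) ⟧) a)))

  recv-base : ∀ v → dg v ≡ 5 → ∀ u → ρ (dg u) + ρ (dg u) ≤ recv v u
  recv-base v d u rewrite d =
    +-mono-≤ (share≥ρ (dg u) (dg (rot u v))) (share≥ρ (dg u) (dg (rot⁻ u v)))

  -- The triangles on both sides of the edge `vu` make the vertices next to `v` around `u` those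
  -- next to `u` around `v`, in opposite order.
  recv-calm : ∀ v → deg G v ≡ 5 → calm v ≡ true → ∀ u → adj G v u ≡ true →
    recv v u ≡ share (dg u) (dg (rot v u)) + share (dg u) (dg (iter (rot v) 4 u))
  recv-calm v d c u a rewrite ≡ᵇ-true (cong cap d) =
    ≡.trans (+-comm (share (dg u) (dg (rot u v))) _)
      (cong₂ _+_ (cong (share (dg u) ∘ dg) next) (cong (share (dg u) ∘ dg) prev))
    where
    next : rot⁻ u v ≡ rot v u
    next = ≡.trans (cong (rot⁻ u) (≡.sym (proj₂ (triangle-rot u v (calm-triangle c u a)))))
      (rot⁻-rot u (rot v u) (triangle-adj a (calm-triangle c u a)))
    x : Fin n
    x = rot⁻ v u
    vx : rot v x ≡ u
    vx = rot-rot⁻ v u a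
    prev : rot u v ≡ iter (rot v) 4 u
    prev = ≡.trans
      (subst (λ z → rot z v ≡ x) vx (proj₁ (triangle-rot x v (calm-triangle c x (rot⁻-adj v u a)))))
      (rot⁻₅ v u d)

  some-nbr : ∀ v → ∃ λ u → adj G v u ≡ true
  some-nbr v with findF (adj G v)
  ... | inj₁ found = found
  ... | inj₂ empty = ⊥-elim (<⇒≱ (s≤s z≤n) (≤-trans (deg≥5 v)
          (≤-reflexive (sumF-zero (λ u → cong ⟦_⟧ (empty u))))))

  module Local (Δ : ℕ) (16≤Δ : 16 ≤ Δ) (deg≤Δ : ∀ v → deg G v ≤ Δ) where
    open Capped Δ 16≤Δ

    -- Listing the neighbours from an arbitrary one gives an instance of `local-balance`; its two
    -- halves serve the calm and the other vertices.
    vertex-balance : ∀ v → deg G v ≡ 5 → Δ + 24 ≤ nbrSum v (deg G) →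
                     240 + nbrSum v (payTo v) ≤ received v + nbrSum v (debtTo v)
    vertex-balance v d heavy = balance (decide (calm v))
      where
      x : Fin n
      x = proj₁ (some-nbr v)
      ax : adj G v x ≡ true
      ax = proj₂ (some-nbr v)
      w : ℕ → Fin n
      w k = iter (rot v) k x
      e₀ = dg (w 0)
      e₁ = dg (w 1)
      e₂ = dg (w 2)
      e₃ = dg (w 3)
      e₄ = dg (w 4)

      bounded : ∀ u → Bounded (deg G u)
      bounded u = deg≥5 u , deg≤Δ u

      numeric : 240 + pays true e₀ e₁ e₂ e₃ e₄ ≤ gain e₀ e₁ e₂ e₃ e₄ + debts true e₀ e₁ e₂ e₃ e₄ ×
                240 + pays false e₀ e₁ e₂ e₃ e₄ ≤ 120 + baseGain e₀ e₁ e₂ e₃ e₄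
      numeric = local-balance e₀ e₁ e₂ e₃ e₄
        (dg-bounds _) (dg-bounds _) (dg-bounds _) (dg-bounds _) (dg-bounds _)
        (cap-fits (deg G (w 0)) (deg G (w 1)) (deg G (w 2)) (deg G (w 3)) (deg G (w 4))
          (bounded _) (bounded _) (bounded _) (bounded _) (bounded _)
          (subst (Δ + 24 ≤_) (nbrSum-cyclic v x ax d (deg G) (λ a b c d e → a)) heavy))

      pay-sum : ∀ t → calm v ≡ t → nbrSum v (payTo v) ≡ pays t e₀ e₁ e₂ e₃ e₄
      pay-sum t refl rewrite ≡ᵇ-true (cong cap d) =
        nbrSum-cyclic v x ax d dg (λ a b c d e → at9 a (pay (calm v) (side b c) (side e d)))

      debt-sum : ∀ t → calm v ≡ t → nbrSum v (debtTo v) ≡ debts t e₀ e₁ e₂ e₃ e₄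
      debt-sum t refl rewrite ≡ᵇ-true (cong cap d) =
        nbrSum-cyclic v x ax d dg (λ a b c d e → at9 a (debt (calm v) (side b c) (side e d)))

      balance : calm v ≡ true ⊎ calm v ≡ false →
                240 + nbrSum v (payTo v) ≤ received v + nbrSum v (debtTo v)
      balance (inj₁ c) = begin
        240 + nbrSum v (payTo v)                     ≡⟨ cong (240 +_) (pay-sum true c) ⟩
        240 + pays true e₀ e₁ e₂ e₃ e₄               ≤⟨ proj₁ numeric ⟩
        gain e₀ e₁ e₂ e₃ e₄ + debts true e₀ e₁ e₂ e₃ e₄
          ≡⟨ cong₂ _+_ (≡.sym gain-sum) (≡.sym (debt-sum true c)) ⟩
        nbrSum v (recv v) + nbrSum v (debtTo v)
          ≤⟨ +-monoˡ-≤ (nbrSum v (debtTo v)) (m≤n+m (nbrSum v (recv v)) _) ⟩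
        received v + nbrSum v (debtTo v) ∎
        where
        open ≤-Reasoning
        gain-sum : nbrSum v (recv v) ≡ gain e₀ e₁ e₂ e₃ e₄
        gain-sum = ≡.trans (sumF-cong λ u → if-cong (adj G v u) (recv-calm v d c u))
          (nbrSum-cyclic v x ax d dg (λ a b c d e → share a b + share a e))
      balance (inj₂ c) = begin
        240 + nbrSum v (payTo v)                     ≡⟨ cong (240 +_) (pay-sum false c) ⟩
        240 + pays false e₀ e₁ e₂ e₃ e₄              ≤⟨ proj₂ numeric ⟩
        120 + baseGain e₀ e₁ e₂ e₃ e₄
          ≡⟨ cong (120 +_) (≡.sym (nbrSum-cyclic v x ax d dg (λ a b c d e → ρ a + ρ a))) ⟩
        -- A vertex that is not calm has at least one large corner.
        120 * 1 + nbrSum v (λ u → ρ (dg u) + ρ (dg u))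
          ≤⟨ +-mono-≤ (*-monoʳ-≤ 120 (positive (large-corners v) c))
                      (nbrSum-mono v (λ u _ → recv-base v (cong cap d) u)) ⟩
        received v                                   ≤⟨ m≤m+n (received v) _ ⟩
        received v + nbrSum v (debtTo v) ∎
        where
        open ≤-Reasoning
        positive : ∀ k → (k ≡ᵇ 0) ≡ false → 1 ≤ k
        positive (suc k) _ = s≤s z≤n

  payTo-nbr : ∀ v a → deg G a ≡ 9 →
              payTo v a ≡ (if dg v ≡ᵇ 5 then pay (calm v) (sideR v a) (sideL v a) else 0)
  payTo-nbr v a d rewrite d = refl

  debtTo-nbr : ∀ v a → deg G a ≡ 9 →
               debtTo v a ≡ (if dg v ≡ᵇ 5 then debt (calm v) (sideR v a) (sideL v a) else 0)
  debtTo-nbr v a d rewrite d = refl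

  -- Consecutive neighbours of a 9-vertex

  stateAt : Fin n → Fin n → State
  stateAt a v = state ((dg v ≡ᵇ 5) ∧ calm v) (sideR v a) (sideL v a)

  deg₅ : ∀ {v} → dg v ≡ 5 → deg G v ≡ 5
  deg₅ = cap-≡ (≤ᵇ⇒≤ 6 16 _)

  -- The neighbour `x` following `v` around `a` precedes `a` around `v`. The other triangle on the
  -- edge `vx` has apex `y`, and both sides read off the degree of `y` after a vertex of degree 5.
  link→ : ∀ a v → adj G a v ≡ true → stateAt a v ≢ none →
          dg (rot a v) ≡ 5 × sideR (rot a v) a ≡ sideL v a
  link→ a v av ne with state-true ((dg v ≡ᵇ 5) ∧ calm v) (sideR v a) (sideL v a) ne
  ... | q , _ , l≢O = subst (λ z → dg z ≡ 5 × sideR z a ≡ sideL v a) (≡.sym next) (dgx , sides)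
    where
    dgv : dg v ≡ 5
    dgv = ≡ᵇ-sound (∧-conicalˡ _ _ q)
    tri : ∀ u → adj G v u ≡ true → triangle (u , v) ≡ true
    tri = calm-triangle (∧-conicalʳ (dg v ≡ᵇ 5) _ q)
    x y : Fin n
    x = iter (rot v) 4 a
    y = iter (rot v) 3 a
    va : adj G v a ≡ true
    va = adj-sym av
    ax : rot v x ≡ a
    ax = period₅ v a va (deg₅ dgv)
    Tx : rot (rot v x) v ≡ x × rot x (rot v x) ≡ v
    Tx = triangle-rot x v (tri x (C.iter-closed v 4 va))
    next : rot a v ≡ x
    next = subst (λ z → rot z v ≡ x) ax (proj₁ Tx)
    xa : rot x a ≡ v
    xa = subst (λ z → rot x z ≡ v) ax (proj₂ Tx)
    xv : rot x v ≡ y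
    xv = proj₁ (triangle-rot y v (tri y (C.iter-closed v 3 va)))
    dgx : dg x ≡ 5
    dgx = side≢O (dg x) (dg y) l≢O
    sides : sideR x a ≡ sideL v a
    sides = cong₂ side (≡.trans (cong dg xa) (≡.trans dgv (≡.sym dgx)))
                       (cong dg (≡.trans (cong (rot x) xa) xv))

  -- Here only the faces around `w` are known to be triangles. They give `y`, `w`, `a` in
  -- consecutive positions around `v`, and the period 5 at `v` turns this into positions 3 and 4
  -- after `a`.
  link← : ∀ a v → adj G a v ≡ true → stateAt a (rot a v) ≢ none →
          dg v ≡ 5 × sideR (rot a v) a ≡ sideL v a
  link← a v av ne
    with state-true ((dg (rot a v) ≡ᵇ 5) ∧ calm (rot a v))
                    (sideR (rot a v) a) (sideL (rot a v) a) ne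
  ... | q , r≢O , _ = dgv , ≡.sym sides
    where
    w y : Fin n
    w = rot a v
    y = rot w (rot w a)
    dgw : dg w ≡ 5
    dgw = ≡ᵇ-sound (∧-conicalˡ _ _ q)
    tri : ∀ u → adj G w u ≡ true → triangle (u , w) ≡ true
    tri = calm-triangle (∧-conicalʳ (dg w ≡ᵇ 5) _ q)
    aw : adj G a w ≡ true
    aw = rot-adj a v av
    wa : adj G w a ≡ true
    wa = adj-sym aw
    Ta : rot (rot w a) w ≡ a × rot a (rot w a) ≡ w
    Ta = triangle-rot a w (tri a wa)
    w→v : rot w a ≡ v
    w→v = rot-inj a (rot w a) v (triangle-adj wa (tri a wa)) av (proj₂ Ta)
    wv : adj G w v ≡ true
    wv = subst (λ z → adj G w z ≡ true) w→v (rot-adj w a wa)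
    Tv : rot (rot w v) w ≡ v × rot v (rot w v) ≡ w
    Tv = triangle-rot v w (tri v wv)
    w→y : rot w v ≡ y
    w→y = cong (rot w) (≡.sym w→v)
    v→w : rot v y ≡ w
    v→w = subst (λ z → rot v z ≡ w) w→y (proj₂ Tv)
    v→a : rot v (rot v y) ≡ a
    v→a = ≡.trans (cong (rot v) v→w) (subst (λ z → rot z w ≡ a) w→v (proj₁ Ta))
    vy : adj G v y ≡ true
    vy = subst (λ z → adj G v z ≡ true) w→y (triangle-adj wv (tri v wv))
    dgv : dg v ≡ 5
    dgv = ≡.trans (cong dg (≡.sym w→v)) (side≢O (dg (rot w a)) (dg y) r≢O)
    round : iter (rot v) 5 y ≡ y
    round = period₅ v y vy (deg₅ dgv)
    sides : sideL v a ≡ sideR w a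
    sides = cong₂ side
      (≡.trans (cong (dg ∘ iter (rot v) 4) (≡.sym v→a)) (≡.trans (cong dg (≡.trans (cong (rot v) round) v→w))
        (≡.trans dgw (≡.trans (≡.sym dgv) (cong dg (≡.sym w→v))))))
      (≡.trans (cong (dg ∘ iter (rot v) 3) (≡.sym v→a)) (cong dg round))

  forced→ : ∀ a v → adj G a v ≡ true → stateAt a v ≢ none →
            forcedR (stateAt a v) ≡ sideR (rot a v) a
  forced→ a v av ne = ≡.trans (proj₁ (state-sides ((dg v ≡ᵇ 5) ∧ calm v) (sideR v a) (sideL v a) ne))
                              (≡.sym (proj₂ (link→ a v av ne)))

  forced← : ∀ a v → adj G a v ≡ true → stateAt a (rot a v) ≢ none →
            forcedL (stateAt a (rot a v)) ≡ sideL v a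
  forced← a v av ne = ≡.trans
    (proj₂ (state-sides ((dg w ≡ᵇ 5) ∧ calm w) (sideR w a) (sideL w a) ne))
    (proj₂ (link← a v av ne))
    where w = rot a v

  -- Two consecutive poor neighbours have equal facing sides, hence opposite orders of `D` and `S`.
  clash-free : ∀ a v → adj G a v ≡ true → clash (stateAt a v) (stateAt a (rot a v)) ≡ false
  clash-free a v av = clash-sides (stateAt a v) ((dg w ≡ᵇ 5) ∧ calm w) (sideR w a) (sideL w a) (forced→ a v av)
    where w = rot a v

  pay-≥ : ∀ a v → deg G a ≡ 9 → adj G a v ≡ true →
          minPay (stateAt a v) (stateAt a (rot a v)) (stateAt a (rot a (rot a v))) ≤ payTo (rot a v) a
  pay-≥ a v d av = ≤-trans
    (minPay-≤ (stateAt a v) (stateAt a (rot a w)) (dg w ≡ᵇ 5) (calm w) (sideR w a) (sideL w a)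
      (λ ne → forced→ a v av ne , ≡ᵇ-true (proj₁ (link→ a v av ne)))
      (λ ne → forced← a w aw ne , ≡ᵇ-true (proj₁ (link← a w aw ne))))
    (≤-reflexive (≡.sym (payTo-nbr w a d)))
    where
    w = rot a v
    aw = rot-adj a v av

  nine-balance : ∀ a → deg G a ≡ 9 →
                 nbrSum a (λ v → debtTo v a) ≤ nbrSum a (λ v → payTo v a)
  nine-balance a d = begin
    nbrSum a (λ v → debtTo v a)                     ≡⟨ around (λ v → debtTo v a) ⟩
    sumF {9} (λ i → debtTo (w (suc (toℕ i))) a)
      ≤⟨ sumF-mono {9} (λ i → ≤-trans (≤-reflexive (debtTo-nbr (w (suc (toℕ i))) a d))
           (debt-≤ (dg (w (suc (toℕ i))) ≡ᵇ 5) (calm (w (suc (toℕ i)))) (sideR (w (suc (toℕ i))) a)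
                   (sideL (w (suc (toℕ i))) a))) ⟩
    sumF {9} (λ i → cost (c (suc (toℕ i))))
      ≤⟨ walk-sound 9 (c 0) (c 1) c 0 0 (walk-nine (c 0) (c 1)) (cong (stateAt a) p)
           (cong (stateAt a ∘ rot a) p) (λ i → clash-free a (w i) (aw i)) ⟩
    sumF {9} (λ i → minPay (c (toℕ i)) (c (suc (toℕ i))) (c (suc (suc (toℕ i)))))
      ≤⟨ sumF-mono {9} (λ i → pay-≥ a (w (toℕ i)) d (aw (toℕ i))) ⟩
    sumF {9} (λ i → payTo (w (suc (toℕ i))) a)      ≡⟨ ≡.sym (around (λ v → payTo v a)) ⟩
    nbrSum a (λ v → payTo v a) ∎
    where
    open ≤-Reasoning
    x : Fin n
    x = proj₁ (some-nbr a)
    ax : adj G a x ≡ true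
    ax = proj₂ (some-nbr a)
    w : ℕ → Fin n
    w k = iter (rot a) k x
    aw : ∀ k → adj G a (w k) ≡ true
    aw k = C.iter-closed a k ax
    c : ℕ → State
    c k = stateAt a (w k)
    p : w 9 ≡ x
    p = subst (λ k → w k ≡ x) d (C.Orbit.period a x ax)
    -- Indices start at 1 because `walk` accounts for the middle state of each window of three.
    around : ∀ f → nbrSum a f ≡ sumF {9} (λ i → f (w (suc (toℕ i))))
    around f = ≡.trans (≡.sym (C.sum-shift a f))
      (subst (λ k → nbrSum a (f ∘ rot a) ≡ sumF {k} (λ i → f (w (suc (toℕ i))))) d
        (C.Orbit.orbit-sum a x ax (f ∘ rot a)))

-- Euler's formula

≡ᵇ-false : ∀ {m k} → m ≢ k → (m ≡ᵇ k) ≡ false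
≡ᵇ-false {m} {k} ne with m ≡ᵇ k in q
... | true  = ⊥-elim (ne (≡ᵇ-sound q))
... | false = refl

<ᵇ-true : ∀ {m k} → m < k → (m <ᵇ k) ≡ true
<ᵇ-true {m} {k} l with m <ᵇ k in q
... | true  = refl
... | false = ⊥-elim (subst T q (<⇒<ᵇ l))

anyF-false : ∀ {n} {P : Fin n → Bool} → (∀ i → P i ≡ false) → anyF P ≡ false
anyF-false {zero}  h = refl
anyF-false {suc n} h rewrite h F.zero = anyF-false (h ∘ F.suc)

-- Vertex 0 is always counted, as no vertex has a smaller index.
components≥1 : ∀ {n} (G : Graph n) → Fin n → 1 ≤ components G
components≥1 {suc n} G _
  rewrite anyF-false {suc n} {P = λ w → (toℕ w <ᵇ 0) ∧ reach G (suc n) w F.zero} (λ w → refl) = s≤s z≤n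

-- The initial charge 240 (d - 6) covers what is sent through d corners, once a 5-vertex is granted
-- the 240 it lacks.
charge-bound : ∀ d → 5 ≤ d → 1440 + 2 * ρ (cap d) * d ≤ 240 * d + 240 * ⟦ cap d ≡ᵇ 5 ⟧
charge-bound d 5≤d with d <? 16
... | yes d<16 = ≤ᵇ⇒≤ _ _ (subst T (≡.sym
    (allFrom-sound 5 11 (λ d → 1440 + 2 * ρ (cap d) * d ≤ᵇ 240 * d + 240 * ⟦ cap d ≡ᵇ 5 ⟧) refl d 5≤d d<16)) _)
... | no  d≮16 rewrite m≥n⇒m⊓n≡n (≮⇒≥ d≮16) = begin
  -- Each corner takes 2 · 75 = 150, and the remaining 90 d reaches 1440 = 90 · 16.
  1440 + 150 * d    ≤⟨ +-monoˡ-≤ (150 * d) (*-monoʳ-≤ 90 (≮⇒≥ d≮16)) ⟩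
  90 * d + 150 * d  ≡⟨ ≡.sym (*-distribʳ-+ d 90 150) ⟩
  240 * d           ≡⟨ ≡.sym (+-identityʳ (240 * d)) ⟩
  240 * d + 0       ∎
  where open ≤-Reasoning

module Euler {n} (G : Graph n) (R : Rotation G) (deg≥5 : ∀ v → 5 ≤ deg G v) where
  open Discharge G R deg≥5
  open FaceCount (λ v → ≤-trans (s≤s (s≤s z≤n)) (deg≥5 v))

  degrees triangular large : ℕ
  degrees    = dartSum (λ _ → 1)
  triangular = dartSum (λ d → ⟦ triangle d ⟧)
  large      = dartSum (λ d → ⟦ not (triangle d) ⟧)

  degrees-split : triangular + large ≡ degrees
  degrees-split = ≡.trans (≡.sym (dartSum-+ (λ d → ⟦ triangle d ⟧) (λ d → ⟦ not (triangle d) ⟧)))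
                          (dartSum-cong (λ d _ → one (triangle d)))
    where
    one : ∀ b → ⟦ b ⟧ + ⟦ not b ⟧ ≡ 1
    one true  = refl
    one false = refl

  handshake : degrees ≡ 2 * edges G
  handshake = begin
    degrees
      ≡⟨ (sumF-cong λ u → ≡.trans (sumF-cong λ v → split u v)
           (sumF-+ (λ v → ⟦ adj G u v ∧ (toℕ u <ᵇ toℕ v) ⟧) (λ v → ⟦ adj G u v ∧ (toℕ v <ᵇ toℕ u) ⟧))) ⟩
    sumF (λ u → up u + down u)   ≡⟨ sumF-+ up down ⟩
    edges G + sumF down          ≡⟨ cong (edges G +_) down≡up ⟩
    edges G + edges G            ≡⟨ cong (edges G +_) (≡.sym (+-identityʳ (edges G))) ⟩
    2 * edges G ∎
    where
    open ≡-Reasoning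
    up down : Fin n → ℕ
    up   u = sumF (λ v → ⟦ adj G u v ∧ (toℕ u <ᵇ toℕ v) ⟧)
    down u = sumF (λ v → ⟦ adj G u v ∧ (toℕ v <ᵇ toℕ u) ⟧)
    down≡up : sumF down ≡ edges G
    down≡up = ≡.trans (sumF-swap (λ u v → ⟦ adj G u v ∧ (toℕ v <ᵇ toℕ u) ⟧))
      (sumF-cong λ v → sumF-cong λ u → cong (λ b → ⟦ b ∧ (toℕ v <ᵇ toℕ u) ⟧) (sym G u v))
    split : ∀ u v → ⟦ adj G u v ⟧ ≡
            ⟦ adj G u v ∧ (toℕ u <ᵇ toℕ v) ⟧ + ⟦ adj G u v ∧ (toℕ v <ᵇ toℕ u) ⟧
    split u v with adj G u v in a
    ... | false = refl
    ... | true with <-cmp (toℕ u) (toℕ v)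
    ...   | tri< l _ _ rewrite <ᵇ-true l | ≥⇒<ᵇ (<⇒≤ l) = refl
    ...   | tri≈ _ e _ = ⊥-elim (adj-≢ a (FP.toℕ-injective e))
    ...   | tri> _ _ l rewrite <ᵇ-true l | ≥⇒<ᵇ (<⇒≤ l) = refl

  no-isolated : isolated G ≡ 0
  no-isolated = sumF-zero (λ v → cong ⟦_⟧ (≡ᵇ-false {deg G v} {0} (λ e →
    <⇒≱ (s≤s z≤n) (≤-trans (deg≥5 v) (≤-reflexive e)))))

  module _ (v₀ : Fin n) (euler : n + faces G R + isolated G ≡ edges G + 2 * components G) where

    euler-≤ : edges G + 2 ≤ n + faces G R
    euler-≤ = begin
      edges G + 2                       ≤⟨ +-monoʳ-≤ (edges G) (*-monoʳ-≤ 2 (components≥1 G v₀)) ⟩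
      edges G + 2 * components G        ≡⟨ ≡.sym euler ⟩
      n + faces G R + isolated G        ≡⟨ cong (n + faces G R +_) no-isolated ⟩
      n + faces G R + 0                 ≡⟨ +-identityʳ _ ⟩
      n + faces G R ∎
      where open ≤-Reasoning

    -- Euler's formula times 1440, with the faces estimated by `faces-bound`; adding its right side,
    -- scaled by 120, to both sides avoids subtraction.
    negative-charge : 240 * degrees + 120 * large + 2880 ≤ 1440 * n
    negative-charge = +-cancelʳ-≤ (480 * triangular + 360 * large) _ _ (begin
      240 * degrees + 120 * large + 2880 + (480 * triangular + 360 * large)
        ≡⟨ cong (λ m → 240 * m + 120 * large + 2880 + (480 * triangular + 360 * large)) (≡.sym degrees-split) ⟩
      240 * (triangular + large) + 120 * large + 2880 + (480 * triangular + 360 * large)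
        ≡⟨ collect triangular large ⟩
      720 * (triangular + large) + 2880
        ≡⟨ cong (λ m → 720 * m + 2880) (≡.trans degrees-split handshake) ⟩
      720 * (2 * edges G) + 2880
        ≡⟨ scale (edges G) ⟩
      1440 * (edges G + 2)
        ≤⟨ *-monoʳ-≤ 1440 euler-≤ ⟩
      1440 * (n + faces G R)
        ≡⟨ scale′ n (faces G R) ⟩
      1440 * n + 120 * (12 * faces G R)
        ≤⟨ +-monoʳ-≤ (1440 * n) (*-monoʳ-≤ 120 faces-bound) ⟩
      1440 * n + 120 * (4 * triangular + 3 * large)
        ≡⟨ cong (1440 * n +_) (scale″ triangular large) ⟩
      1440 * n + (480 * triangular + 360 * large) ∎)
      where
      open ≤-Reasoning
      collect : ∀ t l → 240 * (t + l) + 120 * l + 2880 + (480 * t + 360 * l) ≡ 720 * (t + l) + 2880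
      collect = solve-∀
      scale : ∀ e → 720 * (2 * e) + 2880 ≡ 1440 * (e + 2)
      scale = solve-∀
      scale′ : ∀ n f → 1440 * (n + f) ≡ 1440 * n + 120 * (12 * f)
      scale′ = solve-∀
      scale″ : ∀ t l → 120 * (4 * t + 3 * l) ≡ 480 * t + 360 * l
      scale″ = solve-∀

-- The total charge

module Balance {n} (G : Graph n) (R : Rotation G) (deg≥5 : ∀ v → 5 ≤ deg G v)
  (Δ : ℕ) (16≤Δ : 16 ≤ Δ) (deg≤Δ : ∀ v → deg G v ≤ Δ)
  (heavy : ∀ v → deg G v ≡ 5 → Δ + 24 ≤ sumF (λ u → if adj G v u then deg G u else 0)) where
  open Discharge G R deg≥5
  open Euler G R deg≥5
  open Local Δ 16≤Δ deg≤Δ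

  fives total-received total-pay total-debt : ℕ
  fives          = sumF (λ v → ⟦ dg v ≡ᵇ 5 ⟧)
  total-received = sumF received
  total-pay      = dartSum (λ (v , a) → payTo v a)
  total-debt     = dartSum (λ (v , a) → debtTo v a)

  five-or-not : ∀ v → 240 * ⟦ dg v ≡ᵇ 5 ⟧ + nbrSum v (payTo v) ≤ received v + nbrSum v (debtTo v)
  five-or-not v with decide (dg v ≡ᵇ 5)
  ... | inj₁ p = ≤-trans (≤-reflexive (cong (λ b → 240 * ⟦ b ⟧ + nbrSum v (payTo v)) p))
                         (vertex-balance v d (heavy v d))
    where d = deg₅ (≡ᵇ-sound {dg v} p)
  ... | inj₂ p = ≤-trans (≤-reflexive (cong₂ _+_ (cong (λ b → 240 * ⟦ b ⟧) p) unpaid)) z≤n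
    where
    if-0 : ∀ b → (if b then 0 else 0) ≡ 0
    if-0 true  = refl
    if-0 false = refl
    unpaid : nbrSum v (payTo v) ≡ 0
    unpaid = sumF-zero λ u → ≡.trans
      (if-cong (adj G v u) (λ _ →
        cong (λ b → if b then at9 (dg u) (pay (calm v) (sideR v u) (sideL v u)) else 0) p))
      (if-0 (adj G v u))

  -- Regrouped by corners of `w`: a corner sends `ρ` to each of two 5-vertices or twice that to a
  -- single one. Shifting the second sum by `rot w` brings both shares of a corner together.
  sent≤ : ∀ w → nbrSum w (λ u → recv u w) ≤ 2 * ρ (dg w) * deg G w
  sent≤ w = begin
    nbrSum w (λ u → recv u w)
      ≡⟨ nbrSum-+ w (λ u → κ w u (rot w u)) (λ u → κ w u (rot⁻ w u)) ⟩
    nbrSum w (λ u → κ w u (rot w u)) + nbrSum w (λ u → κ w u (rot⁻ w u))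
      ≡⟨ cong (nbrSum w (λ u → κ w u (rot w u)) +_) (≡.sym (C.sum-shift w (λ u → κ w u (rot⁻ w u)))) ⟩
    nbrSum w (λ u → κ w u (rot w u)) + nbrSum w (λ u → κ w (rot w u) (rot⁻ w (rot w u)))
      ≡⟨ ≡.sym (nbrSum-+ w (λ u → κ w u (rot w u)) (λ u → κ w (rot w u) (rot⁻ w (rot w u)))) ⟩
    nbrSum w (λ u → κ w u (rot w u) + κ w (rot w u) (rot⁻ w (rot w u)))
      ≤⟨ nbrSum-mono w (λ u a → subst (λ z → κ w u (rot w u) + κ w (rot w u) z ≤ 2 * ρ (dg w) * 1)
           (≡.sym (rot⁻-rot w u a)) (corner (rot w u) u)) ⟩
    nbrSum w (λ u → 2 * ρ (dg w) * 1)
      ≡⟨ nbrSum-* w (2 * ρ (dg w)) (λ _ → 1) ⟩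
    2 * ρ (dg w) * deg G w ∎
    where
    open ≤-Reasoning
    corner : ∀ u′ u → κ w u u′ + κ w u′ u ≤ 2 * ρ (dg w) * 1
    corner u′ u with dg u ≡ᵇ 5 | dg u′ ≡ᵇ 5
    ... | true  | true  = ≤-reflexive (double (ρ (dg w)))
      where
      double : ∀ r → r + r ≡ 2 * r * 1
      double = solve-∀
    ... | true  | false = ≤-reflexive (≡.trans (+-identityʳ _) (≡.sym (*-identityʳ _)))
    ... | false | true  = ≤-reflexive (≡.sym (*-identityʳ _))
    ... | false | false = z≤n

  corner-swap : sumF large-corners ≡ large
  corner-swap = dartSum-swap (λ (v , u) → ⟦ not (triangle (u , v)) ⟧)

  received≤ : 1440 * n + total-received ≤ 240 * degrees + 120 * large + 240 * fives
  received≤ = begin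
    1440 * n + total-received
      ≡⟨ cong (1440 * n +_) (≡.trans (sumF-+ (λ v → 120 * large-corners v) (λ v → nbrSum v (recv v)))
           (cong₂ _+_ (≡.trans (sumF-* 120 large-corners) (cong (120 *_) corner-swap))
             (dartSum-swap (λ (v , w) → recv v w)))) ⟩
    1440 * n + (120 * large + sumF (λ w → nbrSum w (λ u → recv u w)))
      ≤⟨ +-monoʳ-≤ (1440 * n) (+-monoʳ-≤ (120 * large) (sumF-mono sent≤)) ⟩
    1440 * n + (120 * large + sumF (λ w → 2 * ρ (dg w) * deg G w))
      ≡⟨ rearrange (1440 * n) (120 * large) _ ⟩
    1440 * n + sumF (λ w → 2 * ρ (dg w) * deg G w) + 120 * large
      ≡⟨ cong (_+ 120 * large) (≡.trans (cong (_+ sumF (λ w → 2 * ρ (dg w) * deg G w))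
           (≡.trans (*-comm 1440 n) (≡.sym (sumF-const n 1440))))
           (≡.sym (sumF-+ (λ (_ : Fin n) → 1440) (λ w → 2 * ρ (dg w) * deg G w)))) ⟩
    sumF (λ w → 1440 + 2 * ρ (dg w) * deg G w) + 120 * large
      ≤⟨ +-monoˡ-≤ (120 * large) (sumF-mono (λ w → charge-bound (deg G w) (deg≥5 w))) ⟩
    sumF (λ w → 240 * deg G w + 240 * ⟦ dg w ≡ᵇ 5 ⟧) + 120 * large
      ≡⟨ cong (_+ 120 * large) (≡.trans (sumF-+ (λ w → 240 * deg G w) (λ w → 240 * ⟦ dg w ≡ᵇ 5 ⟧))
           (cong₂ _+_ (sumF-* 240 (deg G)) (sumF-* 240 (λ w → ⟦ dg w ≡ᵇ 5 ⟧)))) ⟩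
    240 * degrees + 240 * fives + 120 * large
      ≡⟨ ≡.sym (rearrange (240 * degrees) (120 * large) (240 * fives)) ⟩
    240 * degrees + (120 * large + 240 * fives)
      ≡⟨ ≡.sym (+-assoc (240 * degrees) (120 * large) (240 * fives)) ⟩
    240 * degrees + 120 * large + 240 * fives ∎
    where
    open ≤-Reasoning
    rearrange : ∀ a b c → a + (b + c) ≡ a + c + b
    rearrange = solve-∀

  -- Grouping by the receiving vertex leaves only 9-vertices, where `nine-balance` applies.
  debt≤pay : total-debt ≤ total-pay
  debt≤pay = subst₂ _≤_ (≡.sym (dartSum-swap (λ (v , a) → debtTo v a)))
    (≡.sym (dartSum-swap (λ (v , a) → payTo v a))) (sumF-mono at)
    where
    at : ∀ a → nbrSum a (λ v → debtTo v a) ≤ nbrSum a (λ v → payTo v a)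
    at a with decide (dg a ≡ᵇ 9)
    ... | inj₁ p = nine-balance a (cap-≡ (≤ᵇ⇒≤ 10 16 _) (≡ᵇ-sound p))
    ... | inj₂ p = nbrSum-mono a (λ v _ → idle v)
      where
      idle : ∀ v → debtTo v a ≤ payTo v a
      idle v rewrite p with dg v ≡ᵇ 5
      ... | true  = z≤n
      ... | false = z≤n

  fives≤received : 240 * fives ≤ total-received
  fives≤received = +-cancelʳ-≤ total-pay _ _ (begin
    240 * fives + total-pay
      ≡⟨ ≡.trans (cong (_+ total-pay) (≡.sym (sumF-* 240 (λ v → ⟦ dg v ≡ᵇ 5 ⟧))))
           (≡.sym (sumF-+ (λ v → 240 * ⟦ dg v ≡ᵇ 5 ⟧) (λ v → nbrSum v (payTo v)))) ⟩
    sumF (λ v → 240 * ⟦ dg v ≡ᵇ 5 ⟧ + nbrSum v (payTo v))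
      ≤⟨ sumF-mono five-or-not ⟩
    sumF (λ v → received v + nbrSum v (debtTo v))
      ≡⟨ sumF-+ received (λ v → nbrSum v (debtTo v)) ⟩
    total-received + total-debt
      ≤⟨ +-monoʳ-≤ total-received debt≤pay ⟩
    total-received + total-pay ∎)
    where open ≤-Reasoning

  charge-nonnegative : 1440 * n ≤ 240 * degrees + 120 * large
  charge-nonnegative = +-cancelʳ-≤ total-received _ _
    (≤-trans received≤ (+-monoʳ-≤ (240 * degrees + 120 * large) fives≤received))

  euler-fails : Fin n → n + faces G R + isolated G ≢ edges G + 2 * components G
  euler-fails v₀ e = m+1+n≰m (1440 * n)
    (≤-trans (+-monoˡ-≤ 2880 charge-nonnegative) (negative-charge v₀ e))

theorem13 : (n : ℕ) (G : Graph n) → Planar G →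
    (∀ v → 5 ≤ deg G v) →
    (Δ : ℕ) → (∀ v → deg G v ≤ Δ) → (∃ λ v → deg G v ≡ Δ) → 16 ≤ Δ →
    ∃ λ c → deg G c ≡ 5 × starWeight G c ≤ Δ + 28
-- The search for a centre is finite, so a light star is either found or refuted. The vertex `v₀`
-- provides a component for Euler's formula.
theorem13 n G (R , euler) deg≥5 Δ deg≤Δ (v₀ , _) 16≤Δ
  with FP.any? (λ c → (deg G c ≟ 5) ×-dec (starWeight G c ≤? Δ + 28))
... | yes found = found
... | no  absent = ⊥-elim (Balance.euler-fails G R deg≥5 Δ 16≤Δ deg≤Δ heavy v₀ euler)
  where
  nbrs : Fin n → ℕ
  nbrs v = sumF (λ u → if adj G v u then deg G u else 0)
  -- A weight above Δ + 28 is at least Δ + 29, of which the centre accounts for 5.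
  heavy : ∀ v → deg G v ≡ 5 → Δ + 24 ≤ nbrs v
  heavy v d = +-cancelˡ-≤ 5 _ _ (begin
    5 + (Δ + 24)        ≡⟨ shift Δ ⟩
    suc (Δ + 28)        ≤⟨ ≰⇒> (λ w → absent (v , d , w)) ⟩
    deg G v + nbrs v    ≡⟨ cong (_+ nbrs v) d ⟩
    5 + nbrs v ∎)
    where
    open ≤-Reasoning
    shift : ∀ Δ → 5 + (Δ + 24) ≡ suc (Δ + 28)
    shift = solve-∀
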